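{- Let $P\in S_n$ be a permutation and $\mathcal{T}$ any block decomposition tree of $P$. Then the cost of \textsc{RGreedy} run on $P$ with $\mathcal{T}$ satisfies \[\textsc{RGreedy}(P)\le 4\sum_{\tilde P\in N(\mathcal{T})}\textsc{Greedy}(\tilde P)+\sum_{Q\in L(\mathcal{T})}\textsc{Greedy}(Q)+3n,\] where the first sum is over the skeletons of non-leaf nodes and the second over the permutations associated with leaf nodes.
   Context: Geometric model: $P=(x_1,\dots,x_n)$ is the set of access points $\{(x_t,t)\}$ (key, time). $\square_{pq}$ is the closed rectangle with corners $p,q$. \textsc{Greedy} without initial tree: let $\tau(b,t)$ be the largest time $\le t$ at which column $b$ has an output point; at time $t$ with access $(a,t)$, add $(a,t)$ and $(b,t)$ for each $b\ne a$ with $\tau(b,t-1)$ defined such that $\square_{(a,t),(b,\tau(b,t-1))}$ contains no output point at times $<t$ except $(b,\tau(b,t-1))$. For a permutation $Q$, $\textsc{Greedy}(Q)$ is the number of output points of \textsc{Greedy} on $Q$. Blocks: a time interval $[a,b]$ with $\{x_a,\dots,x_b\}=[c,d]$ an interval of keys; the block is the square region $[c,d]\times[a,b]$. A block decomposition tree $\mathcal{T}$ is a rooted tree of blocks with root $[n]\times[n]$, in which every node is a leaf or has children $P_1,\dots,P_k$ ($k\ge2$), blocks whose time intervals partition the node's time interval into consecutive intervals, indexed in increasing time. The skeleton $\tilde P\in S_k$ of a non-leaf node is the permutation order-isomorphic to $(r_1,\dots,r_k)$ with $r_j$ any key of $P_j$; a leaf is associated with the permutation order-isomorphic to its restriction of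 $P$. $N(\mathcal{T})$, $L(\mathcal{T})$: non-leaf and leaf nodes. For a non-leaf node with children $P_1,\dots,P_k$ let $I_1<\dots<I_k$ be the key intervals of the children sorted left to right and $J_j$ the time interval of $P_j$; the regions are $R(i,j)=I_i\times J_j$. For a region $R$ at a given moment, $\mathrm{topleft}(R)$ / $\mathrm{topright}(R)$ are (leftmost key, top time) / (rightmost key, top time) of $R$; $\mathrm{topwing}(R)$ is the set of points $q$ of the current output lying in $R$ that are the topmost output points of their column within $R$ and such that $\square_{q,\mathrm{topleft}(R)}$ or $\square_{q,\mathrm{topright}(R)}$ contains no current output point other than $q$, or $q$ lies in the leftmost or rightmost column of $R$. \textsc{RGreedy} (offline, uses $\mathcal{T}$, no initial tree): at each time $t=1,\dots,n$ with access $(a,t)$, first add the points \textsc{Greedy} would add. Then let $v_1$ (a leaf), $v_2=\mathrm{parent}(v_1),\dots,v_\ell$ be the nodes whose blocks end at time $t$, and $v_{\ell+1}=\mathrm{parent}(v_\ell)$ if it exists. For $h=2,\dots,\ell+1$ in increasing order: with children $P_1,\dots,P_k$ of $v_h$ and $(a,t)\in P_j$, for every $i\in[k]$ add $(q.x,t)$ for every $q\in\mathrm{topwing}(R(i,j))$ (computed with the current output). $\textsc{RGreedy}(P)$ is the total number of output points. -}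

module Defs where

open import Data.Nat using (ℕ; zero; suc; _+_; _*_; _∸_; _≤_; _<_; _⊔_; _⊓_; _≤ᵇ_; _<ᵇ_; _≡ᵇ_)
open import Data.Bool using (Bool; true; false; _∧_; _∨_; not; if_then_else_)
open import Data.List using (List; []; _∷_; map; foldr; foldl; length; upTo; reverse; concatMap; filterᵇ; allFin)
open import Data.List.Membership.Propositional using (_∈_)
open import Data.Product using (_×_; _,_; proj₁; proj₂; Σ)
open import Data.Maybe using (Maybe; just; nothing)
open import Data.Unit using (⊤)
open import Data.Empty using (⊥)
open import Data.Fin using (Fin; toℕ)
open import Data.Fin.Permutation using (Permutation′; _⟨$⟩ʳ_)
open import Function.Bundles using (_⇔_)
open import Relation.Binary.PropositionalEquality using (_≡_)

-- Conventions: keys and times are 0-based (key k ↔ paper's k+1,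
-- time t ↔ paper's t+1).  A sequence of accesses is a list of keys;
-- the access at time t is (x_t , t).

Point : Set
Point = ℕ × ℕ

key : Point → ℕ
key = proj₁

time : Point → ℕ
time = proj₂

keysOf : ∀ {n} → Permutation′ n → List ℕ
keysOf {n} P = map (λ i → toℕ (P ⟨$⟩ʳ i)) (allFin n)

-- x_t (default 0 outside the range; never used there)
lookupD : List ℕ → ℕ → ℕ
lookupD [] _ = 0
lookupD (x ∷ xs) zero = x
lookupD (x ∷ xs) (suc t) = lookupD xs t

range : ℕ → ℕ → List ℕ
range a b = map (a +_) (upTo (suc b ∸ a))

window : List ℕ → ℕ → ℕ → List ℕ
window xs a b = map (lookupD xs) (range a b)

maxL : List ℕ → ℕ
maxL = foldr _⊔_ 0

minL : List ℕ → ℕ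
minL [] = 0
minL (x ∷ xs) = foldr _⊓_ x xs

allB : {A : Set} → (A → Bool) → List A → Bool
allB p [] = true
allB p (x ∷ xs) = p x ∧ allB p xs

eqP : Point → Point → Bool
eqP (x , t) (y , s) = (x ≡ᵇ y) ∧ (t ≡ᵇ s)

memP : Point → List Point → Bool
memP p [] = false
memP p (q ∷ qs) = eqP p q ∨ memP p qs

-- output is a set of points; insertion without duplicates
insertP : Point → List Point → List Point
insertP p S = if memP p S then S else p ∷ S

insertAll : List Point → List Point → List Point
insertAll ps S = foldl (λ S' p → insertP p S') S ps

inRect : Point → Point → Point → Bool
inRect (x₁ , t₁) (x₂ , t₂) (x , t) =
  ((x₁ ⊓ x₂) ≤ᵇ x) ∧ (x ≤ᵇ (x₁ ⊔ x₂)) ∧ ((t₁ ⊓ t₂) ≤ᵇ t) ∧ (t ≤ᵇ (t₁ ⊔ t₂))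

-- Greedy (no initial tree)

tau : List Point → ℕ → ℕ → Maybe ℕ
tau S b t with filterᵇ (λ q → (key q ≡ᵇ b) ∧ (time q <ᵇ t)) S
... | [] = nothing
... | qs@(_ ∷ _) = just (maxL (map time qs))

greedyPoints : List Point → ℕ → ℕ → List Point
greedyPoints S a t = (a , t) ∷ concatMap cand (map key S)
  where
  cand : ℕ → List Point
  cand b with b ≡ᵇ a | tau S b t
  ... | true  | _ = []
  ... | false | nothing = []
  ... | false | just τ =
    if allB (λ r → not ((time r <ᵇ t) ∧ inRect (a , t) (b , τ) r) ∨ eqP r (b , τ)) S
    then (b , t) ∷ [] else []

greedyStep : List ℕ → List Point → ℕ → List Point
greedyStep xs S t = insertAll (greedyPoints S (lookupD xs t) t) S

greedyOutput : List ℕ → List Point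
greedyOutput xs = foldl (greedyStep xs) [] (upTo (length xs))

Greedy : List ℕ → ℕ
Greedy xs = length (greedyOutput xs)

standardize : List ℕ → List ℕ
standardize xs = map (λ x → length (filterᵇ (λ y → y <ᵇ x) xs)) xs

-- Block decomposition trees (a node stores its time interval [a , b])

data BDT : Set where
  leaf : ℕ → ℕ → BDT
  node : ℕ → ℕ → List BDT → BDT

start : BDT → ℕ
start (leaf a _) = a
start (node a _ _) = a

end : BDT → ℕ
end (leaf _ b) = b
end (node _ b _) = b

children : BDT → List BDT
children (leaf _ _) = []
children (node _ _ cs) = cs

IsBlock : List ℕ → ℕ → ℕ → Set
IsBlock xs a b =
  a ≤ b × b < length xs ×
  Σ ℕ λ c → Σ ℕ λ d → ∀ k → ((c ≤ k × k ≤ d) ⇔ (k ∈ window xs a b))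

Consecutive : ℕ → ℕ → List BDT → Set
Consecutive a b [] = ⊥
Consecutive a b (c ∷ []) = start c ≡ a × end c ≡ b
Consecutive a b (c ∷ cs@(_ ∷ _)) = start c ≡ a × Consecutive (suc (end c)) b cs

mutual
  ValidNode : List ℕ → BDT → Set
  ValidNode xs (leaf a b) = IsBlock xs a b
  ValidNode xs (node a b cs) =
    IsBlock xs a b × 2 ≤ length cs × ValidAll xs cs × Consecutive a b cs

  ValidAll : List ℕ → List BDT → Set
  ValidAll xs [] = ⊤
  ValidAll xs (c ∷ cs) = ValidNode xs c × ValidAll xs cs

IsBlockDecompositionTree : ∀ {n} → Permutation′ n → BDT → Set
IsBlockDecompositionTree {n} P 𝒯 =
  start 𝒯 ≡ 0 × suc (end 𝒯) ≡ n × ValidNode (keysOf P) 𝒯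

skeleton : List ℕ → List BDT → List ℕ
skeleton xs cs = standardize (map (λ c → lookupD xs (start c)) cs)

leafPerm : List ℕ → ℕ → ℕ → List ℕ
leafPerm xs a b = standardize (window xs a b)

mutual
  sumNonLeaf : List ℕ → BDT → ℕ
  sumNonLeaf xs (leaf _ _) = 0
  sumNonLeaf xs (node _ _ cs) = Greedy (skeleton xs cs) + sumNonLeafAll xs cs

  sumNonLeafAll : List ℕ → List BDT → ℕ
  sumNonLeafAll xs [] = 0
  sumNonLeafAll xs (c ∷ cs) = sumNonLeaf xs c + sumNonLeafAll xs cs

mutual
  sumLeaf : List ℕ → BDT → ℕ
  sumLeaf xs (leaf a b) = Greedy (leafPerm xs a b)
  sumLeaf xs (node _ _ cs) = sumLeafAll xs cs

  sumLeafAll : List ℕ → List BDT → ℕ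
  sumLeafAll xs [] = 0
  sumLeafAll xs (c ∷ cs) = sumLeaf xs c + sumLeafAll xs cs

mutual
  pathTo : ℕ → BDT → List BDT
  pathTo t (leaf a b) = leaf a b ∷ []
  pathTo t (node a b cs) = node a b cs ∷ pathChildren t cs

  pathChildren : ℕ → List BDT → List BDT
  pathChildren t [] = []
  pathChildren t (c ∷ cs) =
    if (start c ≤ᵇ t) ∧ (t ≤ᵇ end c) then pathTo t c else pathChildren t cs

-- given the leaf-to-root path v_1 , v_2 , … : the pairs (v_{h-1} , v_h)
-- for h = 2 , … , ℓ+1, where v_1 , … , v_ℓ are the nodes ending at t
endPairs : ℕ → List BDT → List (BDT × BDT)
endPairs t (c ∷ rest@(p ∷ _)) = if end c ≡ᵇ t then (c , p) ∷ endPairs t rest else []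
endPairs t _ = []

Region : Set
Region = ℕ × ℕ × ℕ × ℕ

inRegion : Region → Point → Bool
inRegion (xl , xr , tb , tt) (x , s) = (xl ≤ᵇ x) ∧ (x ≤ᵇ xr) ∧ (tb ≤ᵇ s) ∧ (s ≤ᵇ tt)

topwing : List Point → Region → List Point
topwing S R@(xl , xr , tb , tt) = filterᵇ cond S
  where
  topmost : Point → Bool
  topmost q = allB (λ r → not (inRegion R r ∧ (key r ≡ᵇ key q)) ∨ (time r ≤ᵇ time q)) S
  emptyRect : Point → Point → Bool
  emptyRect q c = allB (λ r → not (inRect q c r) ∨ eqP r q) S
  cond : Point → Bool
  cond q = inRegion R q ∧ topmost q ∧
    (emptyRect q (xl , tt) ∨ emptyRect q (xr , tt) ∨ (key q ≡ᵇ xl) ∨ (key q ≡ᵇ xr))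

keyInterval : List ℕ → BDT → ℕ × ℕ
keyInterval xs c = minL (window xs (start c) (end c)) , maxL (window xs (start c) (end c))

-- processing v_h = p whose child containing the access is c = P_j:
-- for every child P_i of p, add (q.x , t) for q ∈ topwing(R(i , j))
processPair : List ℕ → ℕ → List Point → BDT × BDT → List Point
processPair xs t S (c , p) = foldl addRegion S (children p)
  where
  addRegion : List Point → BDT → List Point
  addRegion S' ci with keyInterval xs ci
  ... | (xl , xr) = insertAll (map (λ q → (key q , t)) (topwing S' (xl , xr , start c , end c))) S'

rgreedyStep : List ℕ → BDT → List Point → ℕ → List Point
rgreedyStep xs 𝒯 S t =
  foldl (processPair xs t) (greedyStep xs S t) (endPairs t (reverse (pathTo t 𝒯)))

rgreedyOutput : List ℕ → BDT → List Point
rgreedyOutput xs 𝒯 = foldl (rgreedyStep xs 𝒯) [] (upTo (length xs))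

RGreedy : List ℕ → BDT → ℕ
RGreedy xs 𝒯 = length (rgreedyOutput xs 𝒯)

{-# OPTIONS --safe #-}
module Submission where

open import Defs
open import Data.Bool using (Bool; true; false; T; not; _∧_; _∨_; if_then_else_)
open import Data.Bool.Properties using (T-∧; T-∨)
open import Data.Empty using (⊥; ⊥-elim)
open import Data.Fin as Fin using (Fin; toℕ; fromℕ<)
open import Data.Fin.Permutation using (Permutation′; _⟨$⟩ʳ_; _⟨$⟩ˡ_; inverseˡ)
open import Data.Fin.Properties using (toℕ-fromℕ<; toℕ-injective)
open import Data.List using (List; []; _∷_; _++_; _∷ʳ_; map; foldl; foldr; length; upTo; applyUpTo; tabulate; allFin; concatMap; filterᵇ; reverse)
open import Data.List.Membership.DecPropositional using (_∈?_)
open import Data.List.Membership.Propositional using (_∈_; find; lose)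
open import Data.List.Membership.Propositional.Properties
open import Data.List.Properties hiding (≡-dec)
open import Data.List.Relation.Unary.All as All using (All; []; _∷_)
open import Data.List.Relation.Unary.AllPairs using ([]; _∷_)
open import Data.List.Relation.Unary.Any as Any using (Any; here; there)
open import Data.List.Relation.Unary.Any.Properties using (reverse⁻)
open import Data.List.Relation.Unary.Unique.Propositional using (Unique)
open import Data.Maybe using (Maybe; just; nothing)
open import Data.Nat
open import Data.Nat.Induction using (<-wellFounded)
open import Data.Nat.Properties
open import Data.Nat.Tactic.RingSolver using (solve-∀)
open import Data.Product using (∃; _×_; _,_; proj₁; proj₂)
open import Data.Product.Properties using (≡-dec)
open import Data.Sum using (_⊎_; inj₁; inj₂; [_,_]′)
open import Data.Unit using (tt)
open import Function using (_∘_; id; case_of_)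
open import Function.Bundles using (_⇔_; mk⇔; Equivalence)
open import Induction.WellFounded using (Acc; acc)
open import Relation.Binary.Definitions using (tri<; tri≈; tri>)
open import Relation.Binary.PropositionalEquality
open import Relation.Nullary using (¬_; Dec; yes; no; contradiction)
open import Relation.Nullary.Decidable using (map′; _×-dec_)

open Equivalence using (to; from)

-- Once a non-root block has ended, its two border columns have just been touched, and they shield all its
-- interior columns from then on.  At a node v, the augmentation thus makes every touched region of a row of
-- children end in the top line of that row, so the regions touched at the first access of each child are
-- exactly the points of Greedy on the skeleton of v.  Outside the leaf blocks, an output point therefore lies in
-- a border column of some region of some v, and either
--   * its time is the start or the end of the row and its region is a point of Greedy on the skeleton;
--   * or its time is the end of v (at most two points per child of v);
--   * or it is a greedy point at a time t strictly inside the row; such a point must be the nearest touched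
--     column on the left or on the right of the block in progress, so there are at most two for each t.
-- Inside a leaf block, the output is that of Greedy, except for at most one point per column in the last line.
-- This gives a list of 4 Σ Greedy(skeleton) + Σ Greedy(leaf) + 3 n points that contains the whole output.

-- Greedy's choice at a time depends only on the earlier output and on the order of the keys. Both
-- runs are therefore compared through one predicate, `Touch`, over pairs of access times, by strong
-- induction on the row. The top line of a row is what makes this work: a later access sees a region
-- only through its points late enough, and the skeleton forgets the order of times inside a row.
-- Once every touched region reaches the last line, comparing rows is comparing times.
--
-- The obstacle is the last child of `v`: ancestors of `v` may end together with it and add points
-- in regions that the skeleton leaves empty. These points all have the last time of `v`, and
-- nothing needs to be known about their regions. The diagonal points of the skeleton are always in
-- its output, while a diagonal region is a child itself and is charged at lower nodes, so the slots
-- of the diagonal are free to pay.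
--
-- The greedy points strictly inside a row must not be counted once per level of the tree. Blocks in
-- progress at the same time are nested, and a column beyond the larger one is beyond the smaller
-- one on the same side, so all levels share one nearest column per side.

private variable
  X : Set

-- Rectangles, Boolean tests and duplicate-free point sets.

Between : ℕ → ℕ → ℕ → Set
Between a b y = (a ≤ y × y ≤ b) ⊎ (b ≤ y × y ≤ a)

⊓⊔-between : ∀ a b {y} → a ⊓ b ≤ y → y ≤ a ⊔ b → Between a b y
⊓⊔-between a b {y} l u with ≤-total a b
... | inj₁ a≤b = inj₁ (subst (_≤ y) (m≤n⇒m⊓n≡m a≤b) l , subst (y ≤_) (m≤n⇒m⊔n≡n a≤b) u)
... | inj₂ b≤a = inj₂ (subst (_≤ y) (m≥n⇒m⊓n≡n b≤a) l , subst (y ≤_) (m≥n⇒m⊔n≡m b≤a) u)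

between-⊓⊔ : ∀ {a b y} → Between a b y → a ⊓ b ≤ y × y ≤ a ⊔ b
between-⊓⊔ {a} {b} (inj₁ (l , u)) = ≤-trans (m⊓n≤m a b) l , ≤-trans u (m≤n⊔m a b)
between-⊓⊔ {a} {b} (inj₂ (l , u)) = ≤-trans (m⊓n≤n a b) l , ≤-trans u (m≤m⊔n a b)

inRect⇔ : ∀ p q r → T (inRect p q r) ⇔ (Between (key p) (key q) (key r) × Between (time p) (time q) (time r))
inRect⇔ (x₁ , t₁) (x₂ , t₂) (x , t) = mk⇔ f g
  where
  f : T (inRect (x₁ , t₁) (x₂ , t₂) (x , t)) → Between x₁ x₂ x × Between t₁ t₂ t
  f h with a , h₁ ← to T-∧ h with b , h₂ ← to T-∧ h₁ with c , d ← to T-∧ h₂ =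
    ⊓⊔-between x₁ x₂ (≤ᵇ⇒≤ _ _ a) (≤ᵇ⇒≤ _ _ b) , ⊓⊔-between t₁ t₂ (≤ᵇ⇒≤ _ _ c) (≤ᵇ⇒≤ _ _ d)
  g : Between x₁ x₂ x × Between t₁ t₂ t → T (inRect (x₁ , t₁) (x₂ , t₂) (x , t))
  g (h₁ , h₂) with a , b ← between-⊓⊔ h₁ with c , d ← between-⊓⊔ h₂ =
    from T-∧ (≤⇒≤ᵇ a , from T-∧ (≤⇒≤ᵇ b , from T-∧ (≤⇒≤ᵇ c , ≤⇒≤ᵇ d)))

T-imp : ∀ {a b} → T (not a ∨ b) ⇔ (T a → T b)
T-imp {true}  = mk⇔ (λ h _ → h) (λ h → h tt)
T-imp {false} = mk⇔ (λ _ ()) (λ _ → tt)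

allB⇔ : {p : X → Bool} (l : List X) → T (allB p l) ⇔ (∀ {x} → x ∈ l → T (p x))
allB⇔ [] = mk⇔ (λ _ ()) (λ _ → tt)
allB⇔ {p = p} (x ∷ l) = mk⇔
  (λ { h (here refl) → proj₁ (to T-∧ h) ; h (there i) → to (allB⇔ l) (proj₂ (to T-∧ h)) i })
  (λ h → from T-∧ (h (here refl) , from (allB⇔ {p = p} l) (λ i → h (there i))))

eqP⇔ : ∀ {p q} → T (eqP p q) ⇔ p ≡ q
eqP⇔ {x , t} = mk⇔
  (λ h → let a , b = to T-∧ h in cong₂ _,_ (≡ᵇ⇒≡ _ _ a) (≡ᵇ⇒≡ _ _ b))
  (λ { refl → from (T-∧ {x ≡ᵇ x}) (≡⇒≡ᵇ x x refl , ≡⇒≡ᵇ t t refl) })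

memP⇔ : ∀ {p} S → T (memP p S) ⇔ p ∈ S
memP⇔ [] = mk⇔ (λ ()) (λ ())
memP⇔ {p} (q ∷ S) = mk⇔
  (λ h → [ here ∘ to (eqP⇔ {p} {q}) , there ∘ to (memP⇔ S) ]′ (to T-∨ h))
  (λ { (here e) → from T-∨ (inj₁ (from (eqP⇔ {p} {q}) e)) ; (there i) → from (T-∨ {eqP p q}) (inj₂ (from (memP⇔ S) i)) })

∈-insertP : ∀ {p q} S → p ∈ insertP q S ⇔ (p ≡ q ⊎ p ∈ S)
∈-insertP {p} {q} S with memP q S in eq
... | true  = mk⇔ inj₂ [ (λ { refl → to (memP⇔ S) (subst T (sym eq) tt) }) , id ]′
... | false = mk⇔ (λ { (here e) → inj₁ e ; (there i) → inj₂ i }) [ here , there ]′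

unique-insertP : ∀ q {S} → Unique S → Unique (insertP q S)
unique-insertP q {S} u with memP q S in eq
... | true  = u
... | false = All.tabulate (λ { i refl → subst T eq (from (memP⇔ S) i) }) ∷ u

∈-insertAll : ∀ {p} ps S → p ∈ insertAll ps S ⇔ (p ∈ ps ⊎ p ∈ S)
∈-insertAll [] S = mk⇔ inj₂ λ { (inj₁ ()) ; (inj₂ i) → i }
∈-insertAll (q ∷ ps) S = mk⇔
  (λ h → case to (∈-insertAll ps _) h of λ
    { (inj₁ i) → inj₁ (there i)
    ; (inj₂ i) → [ inj₁ ∘ here , inj₂ ]′ (to (∈-insertP S) i) })
  λ { (inj₁ (here e)) → from (∈-insertAll ps _) (inj₂ (from (∈-insertP S) (inj₁ e)))
    ; (inj₁ (there i)) → from (∈-insertAll ps _) (inj₁ i)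
    ; (inj₂ i) → from (∈-insertAll ps _) (inj₂ (from (∈-insertP S) (inj₂ i))) }

unique-insertAll : ∀ ps {S} → Unique S → Unique (insertAll ps S)
unique-insertAll [] u = u
unique-insertAll (p ∷ ps) u = unique-insertAll ps (unique-insertP p u)

unique-foldl : ∀ (f : List Point → X → List Point) → (∀ {S} a → Unique S → Unique (f S a)) →
  ∀ as {S} → Unique S → Unique (foldl f S as)
unique-foldl f h [] u = u
unique-foldl f h (a ∷ as) u = unique-foldl f h as (h a u)

unique-⊆-length : {xs ys : List X} → Unique xs → (∀ {x} → x ∈ xs → x ∈ ys) → length xs ≤ length ys
unique-⊆-length {xs = []} _ _ = z≤n
unique-⊆-length {xs = x ∷ xs} (x∉ ∷ u) sub with ys₁ , ys₂ , refl ← ∈-∃++ (sub (here refl)) = begin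
  suc (length xs)              ≤⟨ s≤s (unique-⊆-length u sub′) ⟩
  suc (length (ys₁ ++ ys₂))    ≡⟨ cong suc (length-++ ys₁) ⟩
  suc (length ys₁ + length ys₂) ≡⟨ +-suc (length ys₁) (length ys₂) ⟨
  length ys₁ + suc (length ys₂) ≡⟨ length-++ ys₁ ⟨
  length (ys₁ ++ x ∷ ys₂)      ∎
  where
  open ≤-Reasoning
  sub′ : ∀ {z} → z ∈ xs → z ∈ ys₁ ++ ys₂
  sub′ i with ∈-++⁻ ys₁ (sub (there i))
  ... | inj₁ j = ∈-++⁺ˡ j
  ... | inj₂ (here refl) = contradiction refl (All.lookup x∉ i)
  ... | inj₂ (there j) = ∈-++⁺ʳ ys₁ j

∈⇒≤maxL : ∀ {x} l → x ∈ l → x ≤ maxL l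
∈⇒≤maxL (y ∷ l) (here refl) = m≤m⊔n y (maxL l)
∈⇒≤maxL (y ∷ l) (there i) = ≤-trans (∈⇒≤maxL l i) (m≤n⊔m y (maxL l))

maxL-∈ : ∀ {x l} → x ∈ l → maxL l ∈ l
maxL-∈ {l = x ∷ l} _ = go x l
  where
  go : ∀ x l → maxL (x ∷ l) ∈ x ∷ l
  go x [] = here (⊔-identityʳ x)
  go x (y ∷ l) with ≤-total x (maxL (y ∷ l))
  ... | inj₁ h = there (subst (_∈ y ∷ l) (sym (m≤n⇒m⊔n≡n h)) (go y l))
  ... | inj₂ h = here (m≥n⇒m⊔n≡m h)

foldr⊓-≤ : ∀ x l → foldr _⊓_ x l ≤ x × (∀ {y} → y ∈ l → foldr _⊓_ x l ≤ y)
foldr⊓-≤ x [] = ≤-refl , λ ()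
foldr⊓-≤ x (z ∷ l) with h , g ← foldr⊓-≤ x l =
  ≤-trans (m⊓n≤n z _) h , λ { (here refl) → m⊓n≤m z _ ; (there i) → ≤-trans (m⊓n≤n z _) (g i) }

minL-≤∈ : ∀ {x} l → x ∈ l → minL l ≤ x
minL-≤∈ (y ∷ l) (here refl) = proj₁ (foldr⊓-≤ y l)
minL-≤∈ (y ∷ l) (there i) = proj₂ (foldr⊓-≤ y l) i

minL-∈ : ∀ {x l} → x ∈ l → minL l ∈ l
minL-∈ {l = x ∷ l} _ = go l
  where
  go : ∀ l → foldr _⊓_ x l ∈ x ∷ l
  go [] = here refl
  go (y ∷ l) with ≤-total y (foldr _⊓_ x l) | go l
  ... | inj₁ h | _       = there (here (m≤n⇒m⊓n≡m h))
  ... | inj₂ h | here e  = here (trans (m≥n⇒m⊓n≡n h) e)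
  ... | inj₂ h | there i = there (there (subst (_∈ l) (sym (m≥n⇒m⊓n≡n h)) i))

-- Greedy

∈-filterᵇ : ∀ {x} (p : X → Bool) l → x ∈ filterᵇ p l ⇔ (x ∈ l × T (p x))
∈-filterᵇ p l = mk⇔ (∈-filter⁻ _ {xs = l}) (λ (i , h) → ∈-filter⁺ _ i h)

IsTau : List Point → ℕ → ℕ → Maybe ℕ → Set
IsTau S b t nothing  = ∀ {u} → (b , u) ∈ S → u < t → ⊥
IsTau S b t (just τ) = (b , τ) ∈ S × τ < t × (∀ {u} → (b , u) ∈ S → u < t → u ≤ τ)

isTau : ∀ S b t → IsTau S b t (tau S b t)
isTau S b t with filterᵇ (λ q → (key q ≡ᵇ b) ∧ (time q <ᵇ t)) S in eq
... | [] = λ i h → case subst ((b , _) ∈_) eq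
        (from (∈-filterᵇ _ S) (i , from T-∧ (≡⇒≡ᵇ b b refl , <⇒<ᵇ h))) of λ ()
... | q ∷ qs with (b′ , τ) , i , e ← ∈-map⁻ time (maxL-∈ {l = map time (q ∷ qs)} (here refl))
  with j , h ← to (∈-filterᵇ _ S) (subst (_ ∈_) (sym eq) i)
  with k , l ← to T-∧ h
  with refl ← ≡ᵇ⇒≡ b′ b k
  = subst (λ m → IsTau S b t (just m)) (sym e)
    (j , <ᵇ⇒< _ _ l , λ m h → subst (_ ≤_) e (∈⇒≤maxL (map time (q ∷ qs)) (∈-map⁺ time (subst (_ ∈_) eq
      (from (∈-filterᵇ _ S) (m , from T-∧ (≡⇒≡ᵇ b b refl , <⇒<ᵇ h)))))))

-- The equation lets unification find `f`: for `greedyPoints` it is the local function `cand`, which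
-- cannot be named from outside.
∈-∷-concatMap : ∀ {f : ℕ → List Point} {l b p q} L → L ≡ q ∷ concatMap f l → b ∈ l → p ∈ f b → p ∈ L
∈-∷-concatMap L refl i j = there (∈-concatMap⁺ _ (lose i j))

-- `τ` may be any touch of column `b`, not only the last one: other points of column `b` are
-- tolerated, and a later `τ` only shrinks the rectangle. This frees the later arguments from `tau`.
KeyVisible : List Point → ℕ → ℕ → Set
KeyVisible S a b = ∃ λ τ → (b , τ) ∈ S × (∀ {y u} → (y , u) ∈ S → τ ≤ u → Between a b y → y ≡ b)

module _ {S : List Point} {t : ℕ} (below : ∀ {y u} → (y , u) ∈ S → u < t) where

  greedyPoints⁻ : ∀ {a b u} → (b , u) ∈ greedyPoints S a t → u ≡ t × (b ≡ a ⊎ KeyVisible S a b)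
  greedyPoints⁻ (here refl) = refl , inj₁ refl
  greedyPoints⁻ {a} (there i) with c , _ , j ← find (∈-concatMap⁻ _ {xs = map key S} i)
    with c ≡ᵇ a | tau S c t | isTau S c t
  ... | false | just τ | k , τ<t , _
    with allB (λ r → not ((time r <ᵇ t) ∧ inRect (a , t) (c , τ) r) ∨ eqP r (c , τ)) S in eq | j
  ... | true | here refl = refl , inj₂ (τ , k , λ {y} {u} m τ≤u btw →
        cong key (to (eqP⇔ {y , u} {c , τ}) (to T-imp (to (allB⇔ S) (subst T (sym eq) tt) m)
          (from T-∧ (<⇒<ᵇ (below m) ,
             from (inRect⇔ (a , t) (c , τ) (y , u)) (btw , inj₂ (τ≤u , <⇒≤ (below m))))))))

  greedyPoints⁺ : ∀ {a b} → b ≢ a → KeyVisible S a b → (b , t) ∈ greedyPoints S a t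
  greedyPoints⁺ {a} {b} b≢a (τ′ , i , vis)
    with b ≡ᵇ a in eq | tau S b t | isTau S b t | ∈-∷-concatMap {l = map key S} {p = b , t} (greedyPoints S a t) refl (∈-map⁺ key i)
  ... | true  | _ | _ | _ = contradiction (≡ᵇ⇒≡ b a (subst T (sym eq) tt)) b≢a
  ... | false | nothing | h | _ = ⊥-elim (h i (below i))
  ... | false | just τ | j , τ<t , max | intro
    with allB (λ r → not ((time r <ᵇ t) ∧ inRect (a , t) (b , τ) r) ∨ eqP r (b , τ)) S in eq₂
  ... | true  = intro (here refl)
  ... | false = ⊥-elim (subst T eq₂ (from (allB⇔ S) (λ {(y , u)} m → from T-imp λ h →
      let _ , h₂ = to (T-∧ {u <ᵇ t}) h
          bk , bt = to (inRect⇔ (a , t) (b , τ) (y , u)) h₂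
          τ≤u = [ (λ (p , _) → contradiction (below m) (≤⇒≯ p)) , proj₁ ]′ bt
      in from eqP⇔ (same m (vis m (≤-trans (max i (below i)) τ≤u) bk) τ≤u))))
    where
    same : ∀ {y u} → (y , u) ∈ S → y ≡ b → τ ≤ u → (y , u) ≡ (b , τ)
    same m refl τ≤u = cong (b ,_) (≤-antisym (max m (below m)) τ≤u)

-- Runs of a step function, and Greedy's rule in terms of access times.

run : (List Point → ℕ → List Point) → ℕ → List Point
run step zero = []
run step (suc t) = step (run step t) t

foldl-upTo : ∀ step t → foldl step [] (upTo t) ≡ run step t
foldl-upTo step zero = refl
foldl-upTo step (suc t) = begin
  foldl step [] (upTo (suc t))      ≡⟨ cong (foldl step []) (upTo-∷ʳ t) ⟨
  foldl step [] (upTo t ∷ʳ t)       ≡⟨ foldl-∷ʳ step [] t (upTo t) ⟩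
  step (foldl step [] (upTo t)) t   ≡⟨ cong (λ S → step S t) (foldl-upTo step t) ⟩
  step (run step t) t               ∎
  where open ≡-Reasoning

-- O s t stands for the output point (x s , t): a key is named by the time at which it is accessed.

Visible : (ℕ → ℕ → Set) → (ℕ → ℕ) → ℕ → ℕ → Set
Visible O x t s = ∃ λ τ → τ < t × O s τ ×
  (∀ {s′ u} → O s′ u → u < t → τ ≤ u → Between (x t) (x s) (x s′) → s′ ≡ s)

-- Greedy's rule at time `t`. `Visible` inspects only times below `t`, so two processes that obey
-- the rule can be compared by strong induction on time.
Touch : (ℕ → ℕ → Set) → (ℕ → ℕ) → ℕ → ℕ → Set
Touch O x t s = s ≡ t ⊎ Visible O x t s

Distinct : List ℕ → Set
Distinct xs = ∀ {s t} → s < length xs → t < length xs → lookupD xs s ≡ lookupD xs t → s ≡ t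

_∈ₚ?_ : (p : Point) (S : List Point) → Dec (p ∈ S)
_∈ₚ?_ = _∈?_ (≡-dec _≟_ _≟_)

⊆greedyStep : ∀ xs S t {p} → p ∈ S → p ∈ greedyStep xs S t
⊆greedyStep xs S t i = from (∈-insertAll (greedyPoints S (lookupD xs t) t) S) (inj₂ i)

greedyStep⁻ : ∀ xs S t {y u} → (∀ {z v} → (z , v) ∈ S → v < t) → (y , u) ∈ greedyStep xs S t →
  (y , u) ∈ S ⊎ (u ≡ t × ((∃ λ v → (y , v) ∈ S) ⊎ y ≡ lookupD xs t))
greedyStep⁻ xs S t below i with to (∈-insertAll (greedyPoints S (lookupD xs t) t) S) i
... | inj₂ j = inj₁ j
... | inj₁ j with greedyPoints⁻ below j
...   | e , inj₁ e′ = inj₂ (e , inj₂ e′)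
...   | e , inj₂ (v , k , _) = inj₂ (e , inj₁ (v , k))

Visible-map : ∀ {O O′ : ℕ → ℕ → Set} {x x′ : ℕ → ℕ} {t s} →
  (∀ {s u} → O s u → O′ s u) → (∀ {s u} → O′ s u → O s u) →
  (∀ {s′ u} → O′ s′ u → Between (x′ t) (x′ s) (x′ s′) → Between (x t) (x s) (x s′)) →
  Visible O x t s → Visible O′ x′ t s
Visible-map f g h (τ , τ<t , o , vis) = τ , τ<t , f o , λ o′ u<t τ≤u btw → vis (g o′) u<t τ≤u (h o′ btw)

-- Greedy and RGreedy are treated together: all that matters here is that a step contains the greedy
-- one, and that its new points lie on line `t` in a column that is already touched or is accessed
-- now.
module Process
  (xs : List ℕ) (distinct : Distinct xs)
  (step : List Point → ℕ → List Point)
  (greedy⊆step : ∀ S t {p} → p ∈ greedyStep xs S t → p ∈ step S t)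
  (step-new : ∀ S t {y u} → (∀ {z v} → (z , v) ∈ S → v < t) → (y , u) ∈ step S t →
    (y , u) ∈ S ⊎ (u ≡ t × ((∃ λ v → (y , v) ∈ S) ⊎ y ≡ lookupD xs t)))
  where

  n : ℕ
  n = length xs

  x : ℕ → ℕ
  x = lookupD xs

  out : ℕ → List Point
  out = run step

  out-below : ∀ t {y u} → (y , u) ∈ out t → u < t
  out-below (suc t) i with step-new (out t) t (out-below t) i
  ... | inj₁ j = m<n⇒m<1+n (out-below t j)
  ... | inj₂ (refl , _) = n<1+n t

  out-keyed : ∀ t {y u} → (y , u) ∈ out t → ∃ λ s → s ≤ u × y ≡ x s
  out-keyed (suc t) i with step-new (out t) t (out-below t) i
  ... | inj₁ j = out-keyed t j
  ... | inj₂ (refl , inj₂ e) = t , ≤-refl , e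
  ... | inj₂ (refl , inj₁ (v , j)) with s , s≤v , e ← out-keyed t j =
    s , ≤-trans s≤v (<⇒≤ (out-below t j)) , e

  out-mono : ∀ {t t′ p} → t ≤ t′ → p ∈ out t → p ∈ out t′
  out-mono t≤t′ = go (≤⇒≤′ t≤t′)
    where
    go : ∀ {t t′ p} → t ≤′ t′ → p ∈ out t → p ∈ out t′
    go ≤′-refl i = i
    go (≤′-step {t′} h) i = greedy⊆step (out t′) t′ (⊆greedyStep xs (out t′) t′ (go h i))

  out-restrict : ∀ t t′ {y u} → u < t → (y , u) ∈ out t′ → (y , u) ∈ out t
  out-restrict t t′ u<t i with ≤-total t′ t
  ... | inj₁ h = out-mono h i
  ... | inj₂ h = go (≤⇒≤′ h) i
    where
    go : ∀ {t′} → t ≤′ t′ → (_ , _) ∈ out t′ → (_ , _) ∈ out t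
    go ≤′-refl i = i
    go (≤′-step {t′} h) i with step-new (out t′) t′ (out-below t′) i
    ... | inj₁ j = go h j
    ... | inj₂ (refl , _) = contradiction u<t (≤⇒≯ (≤′⇒≤ h))

  O : ℕ → ℕ → Set
  O s t = s < n × t < n × (x s , t) ∈ out n

  O? : ∀ s t → Dec (O s t)
  O? s t = s <? n ×-dec t <? n ×-dec (x s , t) ∈ₚ? out n

  -- There is no initial tree, so a column stays empty until its key is accessed.
  O-≤ : ∀ {s t} → O s t → s ≤ t
  O-≤ (s<n , t<n , i) with s′ , s′≤t , e ← out-keyed n i =
    subst (_≤ _) (sym (distinct s<n (≤-<-trans s′≤t t<n) e)) s′≤t

  Gr : ℕ → ℕ → Set
  Gr s t = (x s , t) ∈ greedyStep xs (out t) t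

  Gr⇒Touch : ∀ {s t} → s < n → t < n → Gr s t → Touch O x t s
  Gr⇒Touch {s} {t} s<n t<n i with to (∈-insertAll (greedyPoints (out t) (x t) t) (out t)) i
  ... | inj₂ j = contradiction (out-below t j) (<-irrefl refl)
  ... | inj₁ j with greedyPoints⁻ (out-below t) j
  ...   | _ , inj₁ e = inj₁ (distinct s<n t<n e)
  ...   | _ , inj₂ (τ , k , vis) = inj₂ (τ , τ<t , (s<n , <-trans τ<t t<n , out-mono (<⇒≤ t<n) k) ,
            λ (s′<n , _ , i′) u<t τ≤u btw → distinct s′<n s<n (vis (out-restrict t n u<t i′) τ≤u btw))
    where τ<t = out-below t k

  Touch⇒Gr : ∀ {s t} → s < n → t < n → Touch O x t s → Gr s t
  Touch⇒Gr {t = t} s<n t<n (inj₁ refl) = from (∈-insertAll (greedyPoints (out t) (x t) t) (out t)) (inj₁ (here refl))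
  Touch⇒Gr {s} {t} s<n t<n (inj₂ (τ , τ<t , o@(_ , _ , i) , vis)) =
    from (∈-insertAll (greedyPoints (out t) (x t) t) (out t)) (inj₁ (greedyPoints⁺ (out-below t)
      (λ e → <⇒≢ (≤-<-trans (O-≤ o) τ<t) (distinct s<n t<n e))
      (τ , out-restrict t n τ<t i , vis′)))
    where
    vis′ : ∀ {y u} → (y , u) ∈ out t → τ ≤ u → Between (x t) (x s) y → y ≡ x s
    vis′ j τ≤u btw with s′ , s′≤u , refl ← out-keyed t j =
      cong x (vis ((≤-<-trans s′≤u u<n) , u<n , out-mono (<⇒≤ t<n) j) (out-below t j) τ≤u btw)
      where u<n = <-trans (out-below t j) t<n

  Gr⇒O : ∀ {s t} → s < n → t < n → Gr s t → O s t
  Gr⇒O {t = t} s<n t<n i = s<n , t<n , out-mono t<n (greedy⊆step (out t) t i)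

-- Greedy on a standardized list.

lookupD-map : ∀ (f : ℕ → ℕ) l {i} → i < length l → lookupD (map f l) i ≡ f (lookupD l i)
lookupD-map f (a ∷ l) {zero} _ = refl
lookupD-map f (a ∷ l) {suc i} (s≤s h) = lookupD-map f l h

lookupD-∈ : ∀ l {i} → i < length l → lookupD l i ∈ l
lookupD-∈ (a ∷ l) {zero} _ = here refl
lookupD-∈ (a ∷ l) {suc i} (s≤s h) = there (lookupD-∈ l h)

indexOf : List ℕ → ℕ → ℕ
indexOf [] y = 0
indexOf (z ∷ zs) y = if z ≡ᵇ y then 0 else suc (indexOf zs y)

indexOf-lookupD : ∀ zs → Distinct zs → ∀ {i} → i < length zs → indexOf zs (lookupD zs i) ≡ i
indexOf-lookupD (z ∷ zs) d {zero} h with z ≡ᵇ z in eq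
... | true  = refl
... | false = ⊥-elim (subst T eq (≡⇒≡ᵇ z z refl))
indexOf-lookupD (z ∷ zs) d {suc i} (s≤s h) with z ≡ᵇ lookupD zs i in eq
... | false = cong suc (indexOf-lookupD zs (λ p q e → suc-injective (d (s≤s p) (s≤s q) e)) h)
... | true  with () ← d z<s (s≤s h) (≡ᵇ⇒≡ z _ (subst T (sym eq) tt))

rank : List ℕ → ℕ → ℕ
rank zs z = length (filterᵇ (λ y → y <ᵇ z) zs)

rank-mono : ∀ zs {z z′} → z ≤ z′ → rank zs z ≤ rank zs z′
rank-mono [] h = z≤n
rank-mono (y ∷ zs) {z} {z′} h with y <ᵇ z in eq | y <ᵇ z′ in eq′
... | true  | true  = s≤s (rank-mono zs h)
... | true  | false = ⊥-elim (subst T eq′ (<⇒<ᵇ (<-≤-trans (<ᵇ⇒< y z (subst T (sym eq) tt)) h)))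
... | false | true  = m≤n⇒m≤1+n (rank-mono zs h)
... | false | false = rank-mono zs h

-- `z` is counted below `z′` but not below itself, hence the hypothesis `z ∈ zs`.
rank-strict : ∀ zs {z z′} → z ∈ zs → z < z′ → rank zs z < rank zs z′
rank-strict (y ∷ zs) {z} {z′} i h with y <ᵇ z in eq | y <ᵇ z′ in eq′ | i
... | true  | true  | here refl = contradiction (<ᵇ⇒< y z (subst T (sym eq) tt)) (<-irrefl refl)
... | true  | true  | there j = s≤s (rank-strict zs j h)
... | true  | false | _ = ⊥-elim (subst T eq′ (<⇒<ᵇ (<-trans (<ᵇ⇒< y z (subst T (sym eq) tt)) h)))
... | false | true  | _ = s≤s (rank-mono zs (<⇒≤ h))
... | false | false | here refl = ⊥-elim (subst T eq′ (<⇒<ᵇ h))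
... | false | false | there j = rank-strict zs j h

-- Keys are replaced by their positions in the list, so that for a skeleton each pair consists of
-- the index of a column child and that of a row child.
greedyIndices : List ℕ → List (ℕ × ℕ)
greedyIndices zs = map (λ (y , j) → indexOf (standardize zs) y , j) (greedyOutput (standardize zs))

length-greedyIndices : ∀ zs → length (greedyIndices zs) ≡ Greedy (standardize zs)
length-greedyIndices zs = length-map _ (greedyOutput (standardize zs))

module _ (zs : List ℕ) (distinct : Distinct zs) where
  private
    k = length zs
    z = lookupD zs
    gs = standardize zs
    g = lookupD gs
    k≡ : length gs ≡ k
    k≡ = length-map _ zs

    g≡ : ∀ {i} → i < k → g i ≡ rank zs (z i)
    g≡ = lookupD-map (rank zs) zs

    g-mono : ∀ {i j} → i < k → j < k → z i ≤ z j → g i ≤ g j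
    g-mono hi hj h = subst₂ _≤_ (sym (g≡ hi)) (sym (g≡ hj)) (rank-mono zs h)

    g-cancel : ∀ {i j} → i < k → j < k → g i ≤ g j → z i ≤ z j
    g-cancel hi hj h = ≮⇒≥ λ lt → ≤⇒≯ h
      (subst₂ _<_ (sym (g≡ hj)) (sym (g≡ hi)) (rank-strict zs (lookupD-∈ zs hj) lt))

    g-distinct : Distinct gs
    g-distinct hi hj e = distinct hi′ hj′
      (≤-antisym (g-cancel hi′ hj′ (≤-reflexive e)) (g-cancel hj′ hi′ (≤-reflexive (sym e))))
      where hi′ = subst (_ <_) k≡ hi
            hj′ = subst (_ <_) k≡ hj

    open Process gs g-distinct (greedyStep gs) (λ _ _ → id) (greedyStep⁻ gs) hiding (x)

    G : ℕ → ℕ → Set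
    G m j = (m , j) ∈ greedyIndices zs

    O⇒G : ∀ {m j} → O m j → G m j
    O⇒G {m} {j} (m<n , j<n , i) = subst (λ m → (m , j) ∈ greedyIndices zs) (indexOf-lookupD gs g-distinct m<n)
      (∈-map⁺ _ (subst ((g m , j) ∈_) (sym (foldl-upTo (greedyStep gs) n)) i))

    G⇒O : ∀ {m j} → G m j → O m j
    G⇒O i with (y , j) , i′ , refl ← ∈-map⁻ _ i
      with i″ ← subst (_ ∈_) (foldl-upTo (greedyStep gs) n) i′
      with s , s≤j , refl ← out-keyed n i″
      with s<n ← ≤-<-trans s≤j (out-below n i″)
      rewrite indexOf-lookupD gs g-distinct s<n = s<n , out-below n i″ , i″

  greedyIndices-bound : ∀ {m j} → (m , j) ∈ greedyIndices zs → m < k × j < k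
  greedyIndices-bound i with m<n , j<n , _ ← G⇒O i = subst (_ <_) k≡ m<n , subst (_ <_) k≡ j<n

  -- Ranks and original keys are ordered alike, so betweenness can be stated with `z`. Together with
  -- `touch-greedyIndices` this characterizes the output by Greedy's rule, and the simulation itself
  -- can be forgotten.
  greedyIndices-touch : ∀ {m j} → (m , j) ∈ greedyIndices zs →
    Touch (λ m j → (m , j) ∈ greedyIndices zs) z j m
  greedyIndices-touch {m} {j} i with o@(m<n , j<n , p) ← G⇒O i
    with m<k , j<k ← greedyIndices-bound i
    -- The step is the greedy one here, so `out (suc j)` unfolds to the set in `Gr`.
    with Gr⇒Touch m<n j<n (out-restrict (suc j) n ≤-refl p)
  ... | inj₁ e = inj₁ e
  ... | inj₂ v = inj₂ (Visible-map O⇒G G⇒O (λ h → btw (proj₁ (greedyIndices-bound h))) v)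
    where
    btw : ∀ {s} → s < k → Between (z j) (z m) (z s) → Between (g j) (g m) (g s)
    btw h (inj₁ (a , b)) = inj₁ (g-mono j<k h a , g-mono h m<k b)
    btw h (inj₂ (a , b)) = inj₂ (g-mono m<k h a , g-mono h j<k b)

  touch-greedyIndices : ∀ {m j} → m < k → j < k →
    Touch (λ m j → (m , j) ∈ greedyIndices zs) z j m → (m , j) ∈ greedyIndices zs
  touch-greedyIndices {m} {j} m<k j<k h = O⇒G (Gr⇒O m<n j<n (Touch⇒Gr m<n j<n (conv h)))
    where
    m<n = subst (_ <_) (sym k≡) m<k
    j<n = subst (_ <_) (sym k≡) j<k
    btw : ∀ {s u} → O s u → Between (g j) (g m) (g s) → Between (z j) (z m) (z s)
    btw o (inj₁ (a , b)) = let h = subst (_ <_) k≡ (proj₁ o) in inj₁ (g-cancel j<k h a , g-cancel h m<k b)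
    btw o (inj₂ (a , b)) = let h = subst (_ <_) k≡ (proj₁ o) in inj₂ (g-cancel m<k h a , g-cancel h j<k b)
    conv : Touch (λ m j → (m , j) ∈ greedyIndices zs) z j m → Touch O g j m
    conv (inj₁ e) = inj₁ e
    conv (inj₂ v) = inj₂ (Visible-map G⇒O O⇒G btw v)

-- The order is a parameter because latest times and access times of extreme keys, in both
-- directions, are all needed.
extremum : ∀ {P : ℕ → Set} {_≼_ : ℕ → ℕ → Set} → (∀ i → Dec (P i)) →
  (∀ i j → i ≼ j ⊎ j ≼ i) → (∀ {i j k} → i ≼ j → j ≼ k → i ≼ k) →
  ∀ {b i} → i < b → P i → ∃ λ m → m < b × P m × (∀ {j} → j < b → P j → j ≼ m)
extremum {P} {_≼_} P? total trans≼ {b} i<b Pi = [ (λ none → ⊥-elim (none i<b Pi)) , id ]′ (search b)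
  where
  search : ∀ b → (∀ {j} → j < b → ¬ P j) ⊎ (∃ λ m → m < b × P m × (∀ {j} → j < b → P j → j ≼ m))
  search zero = inj₁ λ ()
  search (suc b) with P? b | search b
  ... | no ¬Pb | inj₁ none = inj₁ λ j<1+b Pj → case m≤n⇒m<n∨m≡n (s≤s⁻¹ j<1+b) of λ
          { (inj₁ j<b) → none j<b Pj ; (inj₂ refl) → ¬Pb Pj }
  ... | no ¬Pb | inj₂ (m , m<b , Pm , best) = inj₂ (m , m<n⇒m<1+n m<b , Pm , λ j<1+b Pj →
          case m≤n⇒m<n∨m≡n (s≤s⁻¹ j<1+b) of λ
          { (inj₁ j<b) → best j<b Pj ; (inj₂ refl) → contradiction Pj ¬Pb })
  ... | yes Pb | inj₁ none = inj₂ (b , n<1+n b , Pb , λ j<1+b Pj →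
          case m≤n⇒m<n∨m≡n (s≤s⁻¹ j<1+b) of λ
          { (inj₁ j<b) → ⊥-elim (none j<b Pj) ; (inj₂ refl) → [ id , id ]′ (total b b) })
  ... | yes Pb | inj₂ (m , m<b , Pm , best) with total m b
  ...   | inj₁ m≼b = inj₂ (b , n<1+n b , Pb , λ j<1+b Pj →
          case m≤n⇒m<n∨m≡n (s≤s⁻¹ j<1+b) of λ
          { (inj₁ j<b) → trans≼ (best j<b Pj) m≼b ; (inj₂ refl) → [ id , id ]′ (total b b) })
  ...   | inj₂ b≼m = inj₂ (m , m<n⇒m<1+n m<b , Pm , λ j<1+b Pj →
          case m≤n⇒m<n∨m≡n (s≤s⁻¹ j<1+b) of λ
          { (inj₁ j<b) → best j<b Pj ; (inj₂ refl) → b≼m })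

-- Topwings and augmentation

-- Weaker than membership in the topwing: the topmost condition is dropped and other points of
-- column `y` are allowed. It is antitone in the point set, so a wing of the growing output is also
-- one for the output before time `t`.
Wing : List Point → ℕ → ℕ → ℕ → ℕ → ℕ → Set
Wing S xl xr te y v =
  (∀ {y′ v′} → (y′ , v′) ∈ S → xl ≤ y′ → y′ ≤ y → v ≤ v′ → v′ ≤ te → y′ ≡ y) ⊎
  (∀ {y′ v′} → (y′ , v′) ∈ S → y ≤ y′ → y′ ≤ xr → v ≤ v′ → v′ ≤ te → y′ ≡ y) ⊎
  y ≡ xl ⊎ y ≡ xr

Wing-⊆ : ∀ {S S′ xl xr te y v} → (∀ {p} → p ∈ S → p ∈ S′) → Wing S′ xl xr te y v → Wing S xl xr te y v
Wing-⊆ sub (inj₁ w) = inj₁ λ i → w (sub i)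
Wing-⊆ sub (inj₂ (inj₁ w)) = inj₂ (inj₁ λ i → w (sub i))
Wing-⊆ sub (inj₂ (inj₂ w)) = inj₂ (inj₂ w)

inRegion⇔ : ∀ {xl xr tb te y v} → T (inRegion (xl , xr , tb , te) (y , v)) ⇔ (xl ≤ y × y ≤ xr × tb ≤ v × v ≤ te)
inRegion⇔ {xl} {xr} {tb} {te} {y} {v} = mk⇔
  (λ h → let a , h₁ = to (T-∧ {xl ≤ᵇ y}) h ; b , h₂ = to (T-∧ {y ≤ᵇ xr}) h₁ ; c , d = to (T-∧ {tb ≤ᵇ v}) h₂
         in ≤ᵇ⇒≤ _ _ a , ≤ᵇ⇒≤ _ _ b , ≤ᵇ⇒≤ _ _ c , ≤ᵇ⇒≤ _ _ d)
  (λ (a , b , c , d) → from T-∧ (≤⇒≤ᵇ a , from T-∧ (≤⇒≤ᵇ b , from T-∧ (≤⇒≤ᵇ c , ≤⇒≤ᵇ d))))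

emptyRect⁻ : ∀ {S} q c → T (allB (λ r → not (inRect q c r) ∨ eqP r q) S) →
  ∀ {y v} → (y , v) ∈ S → Between (key q) (key c) y → Between (time q) (time c) v → y ≡ key q
emptyRect⁻ {S} q c h {y} {v} i bk bt =
  cong key (to (eqP⇔ {y , v} {q}) (to T-imp (to (allB⇔ S) h i) (from (inRect⇔ q c (y , v)) (bk , bt))))

topwing⁻ : ∀ {S xl xr tb te y v} → (y , v) ∈ topwing S (xl , xr , tb , te) →
  (y , v) ∈ S × (xl ≤ y × y ≤ xr × tb ≤ v × v ≤ te) × Wing S xl xr te y v
topwing⁻ {S} {xl} {xr} {tb} {te} {y} {v} h with i , h₀ ← to (∈-filterᵇ _ S) h
  with a , h₁ ← to (T-∧ {inRegion (xl , xr , tb , te) (y , v)}) h₀ with _ , h₂ ← to T-∧ h₁ =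
  i , to inRegion⇔ a , wing (to T-∨ h₂)
  where
  wing : T _ ⊎ T _ → Wing S xl xr te y v
  wing (inj₁ e) = inj₁ λ j p q r s → emptyRect⁻ (y , v) (xl , te) e j (inj₂ (p , q)) (inj₁ (r , s))
  wing (inj₂ h₃) with to T-∨ h₃
  ... | inj₁ e = inj₂ (inj₁ λ j p q r s → emptyRect⁻ (y , v) (xr , te) e j (inj₁ (p , q)) (inj₁ (r , s)))
  ... | inj₂ h₄ with to T-∨ h₄
  ...   | inj₁ e = inj₂ (inj₂ (inj₁ (≡ᵇ⇒≡ y xl e)))
  ...   | inj₂ e = inj₂ (inj₂ (inj₂ (≡ᵇ⇒≡ y xr e)))

-- For a border column no corner rectangle has to be empty, so being topmost suffices.
topwing⁺ : ∀ {S xl xr tb te y v} → (y , v) ∈ S → xl ≤ y × y ≤ xr × tb ≤ v × v ≤ te →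
  (∀ {v′} → (y , v′) ∈ S → tb ≤ v′ → v′ ≤ te → v′ ≤ v) → y ≡ xl ⊎ y ≡ xr →
  (y , v) ∈ topwing S (xl , xr , tb , te)
topwing⁺ {S} {xl} {xr} {tb} {te} {y} {v} i reg top side = from (∈-filterᵇ _ S) (i ,
  from T-∧ (from inRegion⇔ reg , from T-∧ (topmost ,
    from (T-∨ {empty xl}) (inj₂ (from (T-∨ {empty xr}) (inj₂ (from T-∨ (border side))))))))
  where
  empty : ℕ → Bool
  empty x = allB (λ r → not (inRect (y , v) (x , te) r) ∨ eqP r (y , v)) S
  topmost : T (allB (λ r → not (inRegion (xl , xr , tb , te) r ∧ (key r ≡ᵇ y)) ∨ (time r ≤ᵇ v)) S)
  topmost = from (allB⇔ S) λ {(y′ , v′)} j → from T-imp λ h →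
    let h₁ , h₂ = to (T-∧ {inRegion (xl , xr , tb , te) (y′ , v′)}) h
        _ , _ , p , q = to (inRegion⇔ {xl} {xr} {tb} {te} {y′} {v′}) h₁
    in ≤⇒≤ᵇ (top (subst (λ z → (z , v′) ∈ S) (≡ᵇ⇒≡ y′ y h₂) j) p q)
  border : y ≡ xl ⊎ y ≡ xr → T (y ≡ᵇ xl) ⊎ T (y ≡ᵇ xr)
  border (inj₁ e) = inj₁ (≡⇒≡ᵇ y xl e)
  border (inj₂ e) = inj₂ (≡⇒≡ᵇ y xr e)

foldl-⊆ : ∀ {X : Set} (f : List Point → X → List Point) → (∀ {S a p} → p ∈ S → p ∈ f S a) →
  ∀ as {S p} → p ∈ S → p ∈ foldl f S as
foldl-⊆ f sub [] i = i
foldl-⊆ f sub (a ∷ as) i = foldl-⊆ f sub as (sub i)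

foldl-∈ : ∀ {X : Set} (f : List Point → X → List Point) → (∀ {S a p} → p ∈ S → p ∈ f S a) →
  ∀ {as S a q} → a ∈ as → (∀ {S′} → (∀ {p} → p ∈ S → p ∈ S′) → q ∈ f S′ a) → q ∈ foldl f S as
foldl-∈ f sub {as = a ∷ as} (here refl) h = foldl-⊆ f sub as (h id)
foldl-∈ f sub (there i) h = foldl-∈ f sub i λ sub′ → h (sub′ ∘ sub)

foldl-preserves : ∀ {X : Set} (f : List Point → X → List Point) (Inv : List Point → Set) → ∀ as →
  (∀ {S a} → a ∈ as → Inv S → Inv (f S a)) → ∀ {S} → Inv S → Inv (foldl f S as)
foldl-preserves f Inv [] h inv = inv
foldl-preserves f Inv (a ∷ as) h inv = foldl-preserves f Inv as (h ∘ there) (h (here refl) inv)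

module Augment (xs : List ℕ) where

  leftKey rightKey : BDT → ℕ
  leftKey c = proj₁ (keyInterval xs c)
  rightKey c = proj₂ (keyInterval xs c)

  region : BDT → BDT → Region
  region ci c = leftKey ci , rightKey ci , start c , end c

  augment : ℕ → BDT → List Point → BDT → List Point
  augment t c S ci = insertAll (map (λ q → key q , t) (topwing S (region ci c))) S

  augment-⊆ : ∀ {t c S ci p} → p ∈ S → p ∈ augment t c S ci
  augment-⊆ {t} {c} {S} {ci} i = from (∈-insertAll (map (λ q → key q , t) (topwing S (region ci c))) S) (inj₂ i)

  processPair-⊆ : ∀ {t S cp p} → p ∈ S → p ∈ processPair xs t S cp
  processPair-⊆ {t} {S} {c , p} = foldl-⊆ (augment t c) (λ {S} {ci} → augment-⊆ {t} {c} {S} {ci}) (children p)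

  Augmented : List (BDT × BDT) → List Point → ℕ → Set
  Augmented pairs S y = ∃ λ c → ∃ λ p → ∃ λ ci → ∃ λ v →
    (c , p) ∈ pairs × ci ∈ children p × (y , v) ∈ S × start c ≤ v ×
    leftKey ci ≤ y × y ≤ rightKey ci × Wing S (leftKey ci) (rightKey ci) (end c) y v

  module _ {S₀ : List Point} {t : ℕ} (below : ∀ {y u} → (y , u) ∈ S₀ → u < t) (pairs : List (BDT × BDT)) where

    -- The topwings at time `t` are taken in a growing output that already holds points of line `t`.
    -- The invariant traces every column back: either its point on line `t` is greedy, or it has a
    -- witness in `S₀`, older than `t`.
    processPairs⁻ : ∀ {y u} → (y , u) ∈ foldl (processPair xs t) (greedyStep xs S₀ t) pairs →
      (y , u) ∈ greedyStep xs S₀ t ⊎ (u ≡ t × Augmented pairs S₀ y)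
    processPairs⁻ = proj₂ (foldl-preserves (processPair xs t) Inv pairs
        (λ {_} {(c , p)} j → foldl-preserves (augment t c) Inv (children p) (preserve j)) (⊆greedyStep xs S₀ t , inj₁))
      where
      Inv : List Point → Set
      Inv S = (∀ {p} → p ∈ S₀ → p ∈ S) ×
        (∀ {y u} → (y , u) ∈ S → (y , u) ∈ greedyStep xs S₀ t ⊎ (u ≡ t × Augmented pairs S₀ y))
      preserve : ∀ {c p S ci} → (c , p) ∈ pairs → ci ∈ children p → Inv S → Inv (augment t c S ci)
      preserve {c} {p} {S} {ci} j k (sub , inv) = (λ i → augment-⊆ {t} {c} {S} {ci} (sub i)) , inv′
        where
        inv′ : ∀ {y u} → (y , u) ∈ augment t c S ci →
          (y , u) ∈ greedyStep xs S₀ t ⊎ (u ≡ t × Augmented pairs S₀ y)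
        inv′ i with to (∈-insertAll (map (λ q → key q , t) (topwing S (region ci c))) S) i
        ... | inj₂ i₁ = inv i₁
        ... | inj₁ i₁ with (y , v) , i₂ , refl ← ∈-map⁻ _ i₁
          with i₃ , (yl , yr , vb , vt) , wing ← topwing⁻ {S} i₂
          with inv i₃
        ...   | inj₂ (_ , aug) = inj₂ (refl , aug)
        ...   | inj₁ i₄ with greedyStep⁻ xs S₀ t below i₄
        -- A wing point already on line `t` adds only itself.
        ...     | inj₂ (refl , _) = inj₁ i₄
        ...     | inj₁ i₅ = inj₂ (refl , c , p , ci , v , j , k , i₅ , vb , yl , yr ,
                    Wing-⊆ {S₀} {S} {te = end c} sub wing)

  processPairs⁺ : ∀ {S t c p ci y v pairs} → (c , p) ∈ pairs → ci ∈ children p →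
    leftKey ci ≤ y → y ≤ rightKey ci → y ≡ leftKey ci ⊎ y ≡ rightKey ci →
    (y , v) ∈ S → start c ≤ v → v ≤ end c → (y , t) ∈ foldl (processPair xs t) S pairs
  processPairs⁺ {S} {t} {c} {p} {ci} {y} {v} i j yl yr side k vb vt =
    foldl-∈ (processPair xs t) (λ {S} {cp} → processPair-⊆ {t} {S} {cp}) i λ sub →
      foldl-∈ (augment t c) (λ {S} {ci} → augment-⊆ {t} {c} {S} {ci}) j λ sub′ → add (sub′ (sub k))
    where
    add : ∀ {S} → (y , v) ∈ S → (y , t) ∈ augment t c S ci
    -- The given `v` need not be topmost; the search finds the topmost point of column `y` in the
    -- row.
    add {S} k with extremum {P = λ v → (y , v) ∈ S × start c ≤ v} {_≼_ = _≤_}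
      (λ v → (y , v) ∈ₚ? S ×-dec start c ≤? v) ≤-total ≤-trans (s≤s vt) (k , vb)
    ... | m , m<b , (k′ , mb) , best = from (∈-insertAll _ S) (inj₁ (∈-map⁺ (λ q → key q , t)
          (topwing⁺ k′ (yl , yr , mb , s≤s⁻¹ m<b) (λ k″ b e → best (s≤s e) (k″ , b)) side)))

  unique-processPairs : ∀ {S t} pairs → Unique S → Unique (foldl (processPair xs t) S pairs)
  unique-processPairs {t = t} pairs = unique-foldl (processPair xs t) (λ (c , p) → unique-foldl (augment t c)
    (λ {S} ci → unique-insertAll (map (λ q → key q , t) (topwing S (region ci c)))) (children p)) pairs

-- Block decomposition trees

-- A record and not a pair of inequalities, so that block and time can be inferred from a proof.
record In (w : BDT) (t : ℕ) : Set where
  constructor _,_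
  field
    start≤ : start w ≤ t
    ≤end   : t ≤ end w
open In

record _⊑_ (w v : BDT) : Set where
  constructor _,_
  field
    start-⊑ : start v ≤ start w
    end-⊑   : end w ≤ end v
open _⊑_

infixr 4 _,_

⊑-refl : ∀ {w} → w ⊑ w
⊑-refl = ≤-refl , ≤-refl

⊑-trans : ∀ {u v w} → u ⊑ v → v ⊑ w → u ⊑ w
⊑-trans (a , b) (c , d) = ≤-trans c a , ≤-trans b d

In-⊑ : ∀ {w v t} → w ⊑ v → In w t → In v t
In-⊑ (a , b) (c , d) = ≤-trans a c , ≤-trans d b

data At {A : Set} : List A → ℕ → A → Set where
  here  : ∀ {a l} → At (a ∷ l) zero a
  there : ∀ {a b l m} → At l m a → At (b ∷ l) (suc m) a

At-functional : ∀ {A : Set} {l : List A} {m a b} → At l m a → At l m b → a ≡ b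
At-functional here here = refl
At-functional (there p) (there q) = At-functional p q

∈⇒At : ∀ {A : Set} {l : List A} {a} → a ∈ l → ∃ λ m → At l m a
∈⇒At (here refl) = zero , here
∈⇒At (there i) with m , p ← ∈⇒At i = suc m , there p

At⇒∈ : ∀ {A : Set} {l : List A} {m a} → At l m a → a ∈ l
At⇒∈ here = here refl
At⇒∈ (there p) = there (At⇒∈ p)

At-< : ∀ {A : Set} {l : List A} {m a} → At l m a → m < length l
At-< here = z<s
At-< (there p) = s<s (At-< p)

At-lookup : ∀ {A : Set} {l : List A} {m} → m < length l → ∃ λ a → At l m a
At-lookup {l = a ∷ l} {zero} _ = a , here
At-lookup {l = _ ∷ l} {suc m} (s≤s h) with a , p ← At-lookup {l = l} h = a , there p

lookupD-At : ∀ {A : Set} (f : A → ℕ) {l m a} → At l m a → lookupD (map f l) m ≡ f a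
lookupD-At f here = refl
lookupD-At f (there p) = lookupD-At f p

module _ (P : BDT → Set) (onLeaf : ∀ a b → P (leaf a b))
  (onNode : ∀ a b cs → (∀ {m c} → At cs m c → P c) → P (node a b cs)) where

  BDT-induction : ∀ T → P T
  BDT-inductionAll : ∀ cs {m c} → At cs m c → P c
  BDT-induction (leaf a b) = onLeaf a b
  BDT-induction (node a b cs) = onNode a b cs (BDT-inductionAll cs)
  BDT-inductionAll (c ∷ cs) here = BDT-induction c
  BDT-inductionAll (_ ∷ cs) (there p) = BDT-inductionAll cs p

nodes : BDT → List BDT
nodesAll : List BDT → List BDT
nodes (leaf a b) = leaf a b ∷ []
nodes (node a b cs) = node a b cs ∷ nodesAll cs
nodesAll [] = []
nodesAll (c ∷ cs) = nodes c ++ nodesAll cs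

root∈nodes : ∀ v → v ∈ nodes v
root∈nodes (leaf _ _) = here refl
root∈nodes (node _ _ _) = here refl

∈-nodesAll⁻ : ∀ cs {w} → w ∈ nodesAll cs → ∃ λ m → ∃ λ c → At cs m c × w ∈ nodes c
∈-nodesAll⁻ (c ∷ cs) i with ∈-++⁻ (nodes c) i
... | inj₁ j = zero , c , here , j
... | inj₂ j with m , c′ , p , k ← ∈-nodesAll⁻ cs j = suc m , c′ , there p , k

∈-nodesAll⁺ : ∀ {cs m c w} → At cs m c → w ∈ nodes c → w ∈ nodesAll cs
∈-nodesAll⁺ here i = ∈-++⁺ˡ i
∈-nodesAll⁺ {c′ ∷ _} (there p) i = ∈-++⁺ʳ (nodes c′) (∈-nodesAll⁺ p i)

Edge : BDT → BDT → BDT → Set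
Edge 𝒯 c p = p ∈ nodes 𝒯 × c ∈ children p

Edge⇒node : ∀ 𝒯 {c p} → Edge 𝒯 c p → c ∈ nodes 𝒯
Edge⇒node = BDT-induction (λ 𝒯 → ∀ {c p} → Edge 𝒯 c p → c ∈ nodes 𝒯)
  (λ { a b (here refl , ()) })
  λ { a b cs ih (here refl , i) → there (∈-nodesAll⁺ (proj₂ (∈⇒At i)) (root∈nodes _))
    ; a b cs ih (there j , i) → case ∈-nodesAll⁻ cs j of λ (_ , _ , at , k) → there (∈-nodesAll⁺ at (ih at (k , i))) }

module Valid (xs : List ℕ) where

  valid-≤ : ∀ {v} → ValidNode xs v → start v ≤ end v
  valid-≤ {leaf _ _} (h , _) = h
  valid-≤ {node _ _ _} ((h , _) , _) = h

  valid-block : ∀ {v} → ValidNode xs v → IsBlock xs (start v) (end v)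
  valid-block {leaf _ _} h = h
  valid-block {node _ _ _} (h , _) = h

  validAll-At : ∀ {cs m c} → ValidAll xs cs → At cs m c → ValidNode xs c
  validAll-At (v , _) here = v
  validAll-At (_ , vs) (there p) = validAll-At vs p

  consecutive-⊑ : ∀ {a b} cs {m c} → ValidAll xs cs → Consecutive a b cs → At cs m c → a ≤ start c × end c ≤ b
  consecutive-⊑ (c ∷ []) vs (refl , refl) here = ≤-refl , ≤-refl
  consecutive-⊑ (c ∷ c′ ∷ cs) (v , vs) (refl , con) here with h₁ , h₂ ← consecutive-⊑ (c′ ∷ cs) vs con here =
    ≤-refl , ≤-trans (<⇒≤ h₁) (≤-trans (valid-≤ {c′} (proj₁ vs)) h₂)
  consecutive-⊑ (c ∷ c′ ∷ cs) (v , vs) (refl , con) (there p) with h₁ , h₂ ← consecutive-⊑ (c′ ∷ cs) vs con p =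
    ≤-trans (valid-≤ {c} v) (≤-trans (n≤1+n _) h₁) , h₂

  consecutive-< : ∀ {a b} cs {m m′ c c′} → ValidAll xs cs → Consecutive a b cs →
    At cs m c → At cs m′ c′ → m < m′ → end c < start c′
  consecutive-< (c ∷ c′ ∷ cs) (v , vs) (_ , con) here (there p) _ = proj₁ (consecutive-⊑ (c′ ∷ cs) vs con p)
  consecutive-< (c ∷ c′ ∷ cs) (v , vs) (_ , con) (there p) (there q) (s≤s h) = consecutive-< (c′ ∷ cs) vs con p q h

  consecutive-cover : ∀ {a b} cs {t} → Consecutive a b cs → a ≤ t → t ≤ b →
    ∃ λ m → ∃ λ c → At cs m c × In c t
  consecutive-cover (c ∷ cs) = go c cs
    where
    go : ∀ {a b} c cs {t} → Consecutive a b (c ∷ cs) → a ≤ t → t ≤ b →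
      ∃ λ m → ∃ λ d → At (c ∷ cs) m d × In d t
    go c [] (refl , refl) h₁ h₂ = zero , c , here , h₁ , h₂
    go c (c′ ∷ cs) {t} (refl , con) h₁ h₂ with t ≤? end c
    ... | yes h = zero , c , here , h₁ , h
    ... | no h with m , d , p , q ← go c′ cs con (≰⇒> h) h₂ = suc m , d , there p , q

  consecutive-At-≡ : ∀ {a b cs m m′ c c′ t} → ValidAll xs cs → Consecutive a b cs →
    At cs m c → At cs m′ c′ → In c t → In c′ t → m ≡ m′
  consecutive-At-≡ {cs = cs} {m} {m′} vs con p q (h₁ , h₂) (h₃ , h₄) with <-cmp m m′
  ... | tri≈ _ e _ = e
  ... | tri< h _ _ = contradiction (≤-trans h₃ h₂) (<⇒≱ (consecutive-< cs vs con p q h))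
  ... | tri> _ _ h = contradiction (≤-trans h₁ h₄) (<⇒≱ (consecutive-< cs vs con q p h))

  consecutive-≡ : ∀ {a b cs m m′ c c′ t} → ValidAll xs cs → Consecutive a b cs →
    At cs m c → At cs m′ c′ → In c t → In c′ t → c ≡ c′
  consecutive-≡ {cs = cs} {c = c} vs con p q h h′ =
    At-functional p (subst (λ m → At cs m _) (sym (consecutive-At-≡ vs con p q h h′)) q)

  node-valid : ∀ 𝒯 → ValidNode xs 𝒯 → ∀ {w} → w ∈ nodes 𝒯 → ValidNode xs w × w ⊑ 𝒯
  node-valid = BDT-induction (λ 𝒯 → ValidNode xs 𝒯 → ∀ {w} → w ∈ nodes 𝒯 → ValidNode xs w × w ⊑ 𝒯)
    (λ { a b v (here refl) → v , ⊑-refl })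
    λ { a b cs ih v (here refl) → v , ⊑-refl
      ; a b cs ih (_ , _ , vs , con) (there i) → case ∈-nodesAll⁻ cs i of λ (m , c , at , j) →
          let v , sub = ih at (validAll-At vs at) j
              h₁ , h₂ = consecutive-⊑ cs vs con at
          in v , ⊑-trans sub (h₁ , h₂) }

  child-⊑ : ∀ {v c} → ValidNode xs v → c ∈ children v → c ⊑ v
  child-⊑ {node a b cs} (_ , _ , vs , con) i with h₁ , h₂ ← consecutive-⊑ cs vs con (proj₂ (∈⇒At i)) = h₁ , h₂

  child-valid : ∀ {v c} → ValidNode xs v → c ∈ children v → ValidNode xs c
  child-valid {node a b cs} (_ , _ , vs , con) i = validAll-At vs (proj₂ (∈⇒At i))

  children-≡ : ∀ {v c c′ t} → ValidNode xs v → c ∈ children v → c′ ∈ children v → In c t → In c′ t → c ≡ c′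
  children-≡ {node a b cs} (_ , _ , vs , con) i j = consecutive-≡ vs con (proj₂ (∈⇒At i)) (proj₂ (∈⇒At j))

  -- Nodes containing a common time lie on one path from the root, and a strict ancestor of `c`
  -- contains the whole parent `p`. The form `p ⊑ w`, sharper than `c ⊑ w`, is needed: augmentation
  -- at `c` reaches all columns of `p`.
  laminar : ∀ 𝒯 → ValidNode xs 𝒯 → ∀ {c p w t} → Edge 𝒯 c p → w ∈ nodes 𝒯 → In c t → In w t → w ⊑ c ⊎ p ⊑ w
  laminar = BDT-induction
    (λ 𝒯 → ValidNode xs 𝒯 → ∀ {c p w t} → Edge 𝒯 c p → w ∈ nodes 𝒯 → In c t → In w t → w ⊑ c ⊎ p ⊑ w)
    (λ { a b v (here refl , ()) }) onNode
    where
    onNode : ∀ a b cs → (∀ {m d} → At cs m d → ValidNode xs d →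
        ∀ {c p w t} → Edge d c p → w ∈ nodes d → In c t → In w t → w ⊑ c ⊎ p ⊑ w) →
      ValidNode xs (node a b cs) →
      ∀ {c p w t} → Edge (node a b cs) c p → w ∈ nodes (node a b cs) → In c t → In w t → w ⊑ c ⊎ p ⊑ w
    onNode a b cs ih v (ip , _) (here refl) _ _ = inj₂ (proj₂ (node-valid (node a b cs) v ip))
    onNode a b cs ih (_ , _ , vs , con) {c} {w = w} (here refl , ic) (there iw) ct wt
      with m , d , at , jw ← ∈-nodesAll⁻ cs iw
      with w⊑d ← proj₂ (node-valid d (validAll-At vs at) jw)
      with refl ← consecutive-≡ vs con at (proj₂ (∈⇒At ic)) (In-⊑ w⊑d wt) ct = inj₁ w⊑d
    onNode a b cs ih (_ , _ , vs , con) {c} {p} {w} (there ip , ic) (there iw) ct wt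
      with m , d , at , jw ← ∈-nodesAll⁻ cs iw | m′ , d′ , at′ , jp ← ∈-nodesAll⁻ cs ip
      with w⊑d ← proj₂ (node-valid d (validAll-At vs at) jw)
      with vp , p⊑d′ ← node-valid d′ (validAll-At vs at′) jp
      with refl ← consecutive-≡ vs con at at′ (In-⊑ w⊑d wt)
                    (In-⊑ p⊑d′ (In-⊑ (child-⊑ {p} vp ic) ct))
      = ih at (validAll-At vs at) (jp , ic) jw ct wt

  leaf-⊑ : ∀ 𝒯 → ValidNode xs 𝒯 → ∀ {a b w t} → leaf a b ∈ nodes 𝒯 → w ∈ nodes 𝒯 →
    In (leaf a b) t → In w t → leaf a b ⊑ w
  leaf-⊑ = BDT-induction
    (λ 𝒯 → ValidNode xs 𝒯 → ∀ {a b w t} → leaf a b ∈ nodes 𝒯 → w ∈ nodes 𝒯 →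
       In (leaf a b) t → In w t → leaf a b ⊑ w)
    (λ { a b v (here refl) (here refl) _ _ → ⊑-refl }) onNode
    where
    onNode : ∀ a b cs → (∀ {m d} → At cs m d → ValidNode xs d →
        ∀ {a b w t} → leaf a b ∈ nodes d → w ∈ nodes d → In (leaf a b) t → In w t → leaf a b ⊑ w) →
      ValidNode xs (node a b cs) →
      ∀ {a′ b′ w t} → leaf a′ b′ ∈ nodes (node a b cs) → w ∈ nodes (node a b cs) →
        In (leaf a′ b′) t → In w t → leaf a′ b′ ⊑ w
    onNode a b cs ih v il (here refl) _ _ = proj₂ (node-valid (node a b cs) v il)
    onNode a b cs ih (_ , _ , vs , con) {a′} {b′} {w} (there il) (there iw) lt wt
      with m , d , at , jw ← ∈-nodesAll⁻ cs iw | m′ , d′ , at′ , jl ← ∈-nodesAll⁻ cs il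
      with w⊑d ← proj₂ (node-valid d (validAll-At vs at) jw)
      with l⊑d′ ← proj₂ (node-valid d′ (validAll-At vs at′) jl)
      with refl ← consecutive-≡ vs con at at′ (In-⊑ w⊑d wt) (In-⊑ l⊑d′ lt)
      = ih at (validAll-At vs at) jl jw lt wt

  -- The deepest node that contains both times; this is where the point `O s t` is charged.
  data Meet (𝒯 : BDT) (s t : ℕ) : Set where
    inLeaf  : ∀ {a b} → leaf a b ∈ nodes 𝒯 → In (leaf a b) s → In (leaf a b) t → Meet 𝒯 s t
    atNode : ∀ {a b cs m j c d} → node a b cs ∈ nodes 𝒯 → At cs m c → At cs j d → m ≢ j →
      In c s → In d t → Meet 𝒯 s t

  meet : ∀ 𝒯 → ValidNode xs 𝒯 → ∀ {s t} → In 𝒯 s → In 𝒯 t → Meet 𝒯 s t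
  meet = BDT-induction (λ 𝒯 → ValidNode xs 𝒯 → ∀ {s t} → In 𝒯 s → In 𝒯 t → Meet 𝒯 s t)
    (λ a b v hs ht → inLeaf (here refl) hs ht) onNode
    where
    onNode : ∀ a b cs → (∀ {m d} → At cs m d → ValidNode xs d → ∀ {s t} → In d s → In d t → Meet d s t) →
      ValidNode xs (node a b cs) → ∀ {s t} → In (node a b cs) s → In (node a b cs) t → Meet (node a b cs) s t
    onNode a b cs ih (_ , _ , vs , con) (s₁ , s₂) (t₁ , t₂)
      with m , c , p , cs∋s ← consecutive-cover cs con s₁ s₂
      with j , d , q , d∋t ← consecutive-cover cs con t₁ t₂
      with m ≟ j
    ... | no m≢j = atNode (here refl) p q m≢j cs∋s d∋t
    ... | yes refl with refl ← At-functional p q with ih p (validAll-At vs p) cs∋s d∋t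
    ...   | inLeaf i hs ht = inLeaf (there (∈-nodesAll⁺ p i)) hs ht
    ...   | atNode i at at′ ne hs ht = atNode (there (∈-nodesAll⁺ p i)) at at′ ne hs ht

-- Root-to-leaf paths and the pairs processed at a given time.

reverse-pair : ∀ {A : Set} (pre : List A) c p suf → reverse (pre ++ c ∷ p ∷ suf) ≡ reverse suf ++ p ∷ c ∷ reverse pre
reverse-pair pre c p suf = begin
  reverse (pre ++ c ∷ p ∷ suf)                       ≡⟨ reverse-++ pre (c ∷ p ∷ suf) ⟩
  reverse (c ∷ p ∷ suf) ++ reverse pre               ≡⟨ cong (_++ reverse pre) (unfold-reverse c (p ∷ suf)) ⟩
  (reverse (p ∷ suf) ++ c ∷ []) ++ reverse pre       ≡⟨ ++-assoc (reverse (p ∷ suf)) (c ∷ []) (reverse pre) ⟩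
  reverse (p ∷ suf) ++ c ∷ reverse pre               ≡⟨ cong (_++ c ∷ reverse pre) (unfold-reverse p suf) ⟩
  (reverse suf ++ p ∷ []) ++ c ∷ reverse pre         ≡⟨ ++-assoc (reverse suf) (p ∷ []) (c ∷ reverse pre) ⟩
  reverse suf ++ p ∷ c ∷ reverse pre                 ∎
  where open ≡-Reasoning

endPairs⁻ : ∀ {t} l {c p} → (c , p) ∈ endPairs t l →
  end c ≡ t × ∃ λ pre → ∃ λ suf → l ≡ pre ++ c ∷ p ∷ suf
endPairs⁻ {t} (a ∷ b ∷ l) i with end a ≡ᵇ t in eq
endPairs⁻ {t} (a ∷ b ∷ l) (here refl) | true = ≡ᵇ⇒≡ _ t (subst T (sym eq) _) , [] , l , refl
endPairs⁻ {t} (a ∷ b ∷ l) (there i)   | true with e , pre , suf , e′ ← endPairs⁻ (b ∷ l) i =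
  e , a ∷ pre , suf , cong (a ∷_) e′

endPairs-∷ : ∀ {t a b} l {q} → end a ≡ t → q ≡ (a , b) ⊎ q ∈ endPairs t (b ∷ l) → q ∈ endPairs t (a ∷ b ∷ l)
endPairs-∷ {t} {a} l e h with end a ≡ᵇ t in eq
... | true  = [ here , there ]′ h
... | false = ⊥-elim (subst T eq (≡⇒≡ᵇ _ t e))

endPairs⁺ : ∀ {t} pre {c p} suf → All (λ w → end w ≡ t) pre → end c ≡ t → (c , p) ∈ endPairs t (pre ++ c ∷ p ∷ suf)
endPairs⁺ [] suf [] e = endPairs-∷ suf e (inj₁ refl)
endPairs⁺ (a ∷ []) suf (ea ∷ []) e = endPairs-∷ (_ ∷ suf) ea (inj₂ (endPairs⁺ [] suf [] e))
endPairs⁺ (a ∷ a′ ∷ pre) suf (ea ∷ es) e = endPairs-∷ (pre ++ _ ∷ _ ∷ suf) ea (inj₂ (endPairs⁺ (a′ ∷ pre) suf es e))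

pathTo-head : ∀ t v → ∃ λ l → pathTo t v ≡ v ∷ l
pathTo-head t (leaf _ _) = _ , refl
pathTo-head t (node _ _ _) = _ , refl

pathChildren-cases : ∀ t cs → pathChildren t cs ≡ [] ⊎ ∃ λ m → ∃ λ c → At cs m c × pathChildren t cs ≡ pathTo t c
pathChildren-cases t [] = inj₁ refl
pathChildren-cases t (c ∷ cs) with (start c ≤ᵇ t) ∧ (t ≤ᵇ end c)
... | true  = inj₂ (zero , c , here , refl)
... | false with pathChildren-cases t cs
...   | inj₁ e = inj₁ e
...   | inj₂ (m , d , p , e) = inj₂ (suc m , d , there p , e)

pathTo⇒Edge : ∀ {t} 𝒯 → ∀ pre {c p suf} → pathTo t 𝒯 ≡ pre ++ p ∷ c ∷ suf → Edge 𝒯 c p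
pathTo⇒Edge {t} = BDT-induction (λ 𝒯 → ∀ pre {c p suf} → pathTo t 𝒯 ≡ pre ++ p ∷ c ∷ suf → Edge 𝒯 c p)
  onLeaf onNode
  where
  onLeaf : ∀ a b → ∀ pre {c p suf} → pathTo t (leaf a b) ≡ pre ++ p ∷ c ∷ suf → Edge (leaf a b) c p
  onLeaf a b [] ()
  onLeaf a b (_ ∷ []) ()
  onLeaf a b (_ ∷ _ ∷ _) ()
  onNode : ∀ a b cs → (∀ {m d} → At cs m d → ∀ pre {c p suf} → pathTo t d ≡ pre ++ p ∷ c ∷ suf → Edge d c p) →
    ∀ pre {c p suf} → pathTo t (node a b cs) ≡ pre ++ p ∷ c ∷ suf → Edge (node a b cs) c p
  onNode a b cs ih [] e with refl , e′ ← ∷-injective e with pathChildren-cases t cs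
  ... | inj₁ e″ with () ← trans (sym e″) e′
  ... | inj₂ (m , d , at , e″) with l , e‴ ← pathTo-head t d
    with refl , _ ← ∷-injective (trans (sym e‴) (trans (sym e″) e′)) = here refl , At⇒∈ at
  onNode a b cs ih (v ∷ pre) e with refl , e′ ← ∷-injective e with pathChildren-cases t cs
  ... | inj₁ e″ = ⊥-elim (nonempty pre (trans (sym e″) e′))
    where
    nonempty : ∀ pre {p : BDT} {l} → [] ≢ pre ++ p ∷ l
    nonempty [] ()
    nonempty (_ ∷ _) ()
  ... | inj₂ (m , d , at , e″) with ip , ic ← ih at pre (trans (sym e″) e′) = there (∈-nodesAll⁺ at ip) , ic

module Path (xs : List ℕ) where
  open Valid xs

  pathChildren-At : ∀ {a b} cs {m c t} → ValidAll xs cs → Consecutive a b cs → At cs m c → In c t →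
    pathChildren t cs ≡ pathTo t c
  pathChildren-At (c ∷ cs) {t = t} vs con here (h₁ , h₂) with (start c ≤ᵇ t) ∧ (t ≤ᵇ end c) in eq
  ... | true  = refl
  ... | false = ⊥-elim (subst T eq (from T-∧ (≤⇒≤ᵇ h₁ , ≤⇒≤ᵇ h₂)))
  pathChildren-At (c ∷ c′ ∷ cs) {t = t} vs con (there p) h with (start c ≤ᵇ t) ∧ (t ≤ᵇ end c) in eq
  ... | false = pathChildren-At (c′ ∷ cs) (proj₂ vs) (proj₂ con) p h
  ... | true  = contradiction (≤-trans (start≤ h) (≤ᵇ⇒≤ t _ (proj₂ (to (T-∧ {start c ≤ᵇ t}) (subst T (sym eq) _)))))
                  (<⇒≱ (consecutive-< (c ∷ c′ ∷ cs) vs con here (there p) z<s))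

  pathTo-In : ∀ {t} 𝒯 → ValidNode xs 𝒯 → In 𝒯 t → All (λ w → In w t × w ⊑ 𝒯) (pathTo t 𝒯)
  pathTo-In {t} = BDT-induction (λ 𝒯 → ValidNode xs 𝒯 → In 𝒯 t → All (λ w → In w t × w ⊑ 𝒯) (pathTo t 𝒯))
    (λ a b v h → (h , ⊑-refl) ∷ [])
    λ { a b cs ih (_ , _ , vs , con) h → (h , ⊑-refl) ∷
          (let m , c , at , h′ = consecutive-cover cs con (start≤ h) (≤end h)
               c⊑₁ , c⊑₂ = consecutive-⊑ cs vs con at
           in subst (All _) (sym (pathChildren-At cs vs con at h′))
                (All.map (λ (i , sub) → i , ⊑-trans sub (c⊑₁ , c⊑₂)) (ih at (validAll-At vs at) h′))) }

  Edge⇒pathTo : ∀ {t} 𝒯 → ValidNode xs 𝒯 → ∀ {c p} → Edge 𝒯 c p → In c t →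
    ∃ λ pre → ∃ λ suf → pathTo t 𝒯 ≡ pre ++ p ∷ c ∷ suf × All (λ w → In w t × w ⊑ c) suf
  Edge⇒pathTo {t} = BDT-induction (λ 𝒯 → ValidNode xs 𝒯 → ∀ {c p} → Edge 𝒯 c p → In c t →
      ∃ λ pre → ∃ λ suf → pathTo t 𝒯 ≡ pre ++ p ∷ c ∷ suf × All (λ w → In w t × w ⊑ c) suf)
    (λ { a b v (here refl , ()) }) onNode
    where
    onNode : ∀ a b cs → (∀ {m d} → At cs m d → ValidNode xs d → ∀ {c p} → Edge d c p → In c t →
        ∃ λ pre → ∃ λ suf → pathTo t d ≡ pre ++ p ∷ c ∷ suf × All (λ w → In w t × w ⊑ c) suf) →
      ValidNode xs (node a b cs) → ∀ {c p} → Edge (node a b cs) c p → In c t →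
        ∃ λ pre → ∃ λ suf → pathTo t (node a b cs) ≡ pre ++ p ∷ c ∷ suf × All (λ w → In w t × w ⊑ c) suf
    onNode a b cs ih (_ , _ , vs , con) {c} (here refl , ic) h
      with m , at ← ∈⇒At ic
      with l , e ← pathTo-head t c
      with e′ ← pathChildren-At cs vs con at h =
      [] , l , cong (node a b cs ∷_) (trans e′ e) ,
        All.tail (subst (All _) e (pathTo-In c (validAll-At vs at) h))
    onNode a b cs ih (_ , _ , vs , con) {c} {p} (there ip , ic) h
      with m , d , at , jp ← ∈-nodesAll⁻ cs ip
      with vp , p⊑d ← node-valid d (validAll-At vs at) jp
      with pre , suf , e , al ← ih at (validAll-At vs at) (jp , ic) h =
      node a b cs ∷ pre , suf ,
        cong (node a b cs ∷_) (trans (pathChildren-At cs vs con at (In-⊑ p⊑d (In-⊑ (child-⊑ vp ic) h))) e) , al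

  stepPairs : ℕ → BDT → List (BDT × BDT)
  stepPairs t 𝒯 = endPairs t (reverse (pathTo t 𝒯))

  stepPairs⁻ : ∀ {t} 𝒯 {c p} → (c , p) ∈ stepPairs t 𝒯 → end c ≡ t × Edge 𝒯 c p
  stepPairs⁻ {t} 𝒯 {c} {p} i with e , pre , suf , e′ ← endPairs⁻ (reverse (pathTo t 𝒯)) i =
    e , pathTo⇒Edge 𝒯 (reverse suf)
      (trans (sym (reverse-involutive (pathTo t 𝒯))) (trans (cong reverse e′) (reverse-pair pre c p suf)))

  -- A node below `c` on the path to `end c` contains that time and ends no later than `c`, so it
  -- ends there too. Hence the walk up from the leaf reaches the pair.
  stepPairs⁺ : ∀ 𝒯 → ValidNode xs 𝒯 → ∀ {c p} → Edge 𝒯 c p → (c , p) ∈ stepPairs (end c) 𝒯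
  stepPairs⁺ 𝒯 v {c} {p} edge
    with vc , _ ← node-valid 𝒯 v (Edge⇒node 𝒯 edge)
    with pre , suf , e , al ← Edge⇒pathTo 𝒯 v edge (valid-≤ vc , ≤-refl) =
    subst (λ l → (c , p) ∈ endPairs (end c) l) (sym (trans (cong reverse e) (reverse-pair pre p c suf)))
      (endPairs⁺ (reverse suf) (reverse pre) (All.tabulate λ {w} i →
        let h , sub = All.lookup al (reverse⁻ i) in ≤-antisym (end-⊑ sub) (≤end h)) refl)

-- Windows and key intervals of blocks.

range⁻ : ∀ a b {t} → t ∈ range a b → a ≤ t × t ≤ b
range⁻ a b i with m , j , refl ← ∈-map⁻ (a +_) i with j<k ← ∈-upTo⁻ j =
  m≤m+n a m , s≤s⁻¹ (subst (_< suc b) (+-comm m a)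
    (m≤o∸n⇒m+n≤o (suc m) (<⇒≤ (m∸n≢0⇒n<m {suc b} (m<n⇒n≢0 j<k))) j<k))

range⁺ : ∀ a b {t} → a ≤ t → t ≤ b → t ∈ range a b
range⁺ a b {t} a≤t t≤b = subst (_∈ range a b) (m+[n∸m]≡n a≤t)
  (∈-map⁺ (a +_) (∈-upTo⁺ (∸-monoˡ-< (s≤s t≤b) a≤t)))

lookupD-applyUpTo : ∀ (f : ℕ → ℕ) k {m} → m < k → lookupD (applyUpTo f k) m ≡ f m
lookupD-applyUpTo f (suc k) {zero} _ = refl
lookupD-applyUpTo f (suc k) {suc m} (s≤s h) = lookupD-applyUpTo (f ∘ suc) k h

-- The search returns 0 when nothing below b satisfies P.
pick : {P : ℕ → Set} → (∀ i → Dec (P i)) → ℕ → ℕ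
pick P? b with anyUpTo? P? b
... | yes (i , _) = i
... | no _ = 0

pick-≡ : ∀ {P : ℕ → Set} (P? : ∀ i → Dec (P i)) b → (∀ {i j} → i < b → j < b → P i → P j → i ≡ j) →
  ∀ {i} → i < b → P i → pick P? b ≡ i
pick-≡ P? b unique i<b Pi with anyUpTo? P? b
... | yes (j , j<b , Pj) = unique j<b i<b Pj Pi
... | no none = contradiction (_ , i<b , Pi) none

module Block (xs : List ℕ) (distinct : Distinct xs) where
  open Augment xs
  open Valid xs

  private
    x = lookupD xs
    n = length xs

  window⁻ : ∀ {a b y} → y ∈ window xs a b → ∃ λ t → a ≤ t × t ≤ b × y ≡ x t
  window⁻ {a} {b} i with t , j , e ← ∈-map⁻ x i with h₁ , h₂ ← range⁻ a b j = t , h₁ , h₂ , e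

  window⁺ : ∀ {a b t} → a ≤ t → t ≤ b → x t ∈ window xs a b
  window⁺ {a} {b} h₁ h₂ = ∈-map⁺ x (range⁺ a b h₁ h₂)

  leftKey-≤ : ∀ {v s} → In v s → leftKey v ≤ x s
  leftKey-≤ {v} (h₁ , h₂) = minL-≤∈ (window xs (start v) (end v)) (window⁺ h₁ h₂)

  ≤-rightKey : ∀ {v s} → In v s → x s ≤ rightKey v
  ≤-rightKey {v} (h₁ , h₂) = ∈⇒≤maxL (window xs (start v) (end v)) (window⁺ h₁ h₂)

  leftKey-attained : ∀ {v} → ValidNode xs v → ∃ λ s → In v s × x s ≡ leftKey v
  leftKey-attained {v} val with s , h₁ , h₂ , e ← window⁻ (minL-∈ (window⁺ ≤-refl (valid-≤ {v} val))) =
    s , (h₁ , h₂) , sym e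

  rightKey-attained : ∀ {v} → ValidNode xs v → ∃ λ s → In v s × x s ≡ rightKey v
  rightKey-attained {v} val with s , h₁ , h₂ , e ← window⁻ (maxL-∈ (window⁺ ≤-refl (valid-≤ {v} val))) =
    s , (h₁ , h₂) , sym e

  In⇒<n : ∀ {v s} → ValidNode xs v → In v s → s < n
  In⇒<n val h with _ , b<n , _ ← valid-block val = ≤-<-trans (≤end h) b<n

  -- The accessed keys form an interval that contains both extreme keys, so `x s` is accessed inside
  -- the block, and distinctness identifies that access with `s`.
  convex : ∀ {v s} → ValidNode xs v → s < n → leftKey v ≤ x s → x s ≤ rightKey v → In v s
  convex {v} {s} val s<n l r
    with _ , _ , c , d , iff ← valid-block {v} val
    with sl , hl , el ← leftKey-attained val | sr , hr , er ← rightKey-attained val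
    with t , h₁ , h₂ , e ← window⁻ (to (iff (x s))
      ( ≤-trans (proj₁ (from (iff _) (window⁺ (start≤ hl) (≤end hl)))) (≤-trans (≤-reflexive el) l)
      , ≤-trans (≤-trans r (≤-reflexive (sym er))) (proj₂ (from (iff _) (window⁺ (start≤ hr) (≤end hr))))))
    with refl ← distinct s<n (In⇒<n {v} val (h₁ , h₂)) e = h₁ , h₂

  outside : ∀ {v s} → ValidNode xs v → s < n → ¬ In v s → x s < leftKey v ⊎ rightKey v < x s
  outside {v} {s} val s<n h with x s <? leftKey v | rightKey v <? x s
  ... | yes p | _ = inj₁ p
  ... | no _ | yes q = inj₂ q
  ... | no p | no q = contradiction (convex val s<n (≮⇒≥ p) (≮⇒≥ q)) h

  -- Key intervals of disjoint blocks do not overlap, so one comparison decides all of them. This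
  -- reduces comparisons between columns of two children to the first keys of the children, that is,
  -- to the skeleton.
  separate : ∀ {c d s₁ s₂ r₁ r₂} → ValidNode xs c → ValidNode xs d → (∀ {t} → In c t → ¬ In d t) →
    In c s₁ → In c s₂ → In d r₁ → In d r₂ → x s₁ ≤ x r₁ → x s₂ < x r₂
  separate {c} {d} vc vd disj hs₁ hs₂ hr₁ hr₂ le
    with outside vc (In⇒<n vd hr₁) (λ h → disj h hr₁) | outside vc (In⇒<n vd hr₂) (λ h → disj h hr₂)
  ... | inj₁ lt | _ = contradiction le (<⇒≱ (<-≤-trans lt (leftKey-≤ hs₁)))
  ... | inj₂ _  | inj₂ gt = ≤-<-trans (≤-rightKey hs₂) gt
  -- `d` would have keys on both sides of `c`, and convexity would put `c` inside it.
  ... | inj₂ gt | inj₁ lt = ⊥-elim (disj hs₂ (convex vd (In⇒<n vc hs₂)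
        (≤-trans (leftKey-≤ hr₂) (<⇒≤ (<-≤-trans lt (leftKey-≤ hs₂))))
        (≤-trans (<⇒≤ (≤-<-trans (≤-rightKey hs₂) gt)) (≤-rightKey hr₁))))

-- The points paid for by each node, and their number.

length-concatMap : ∀ {A B : Set} (f : A → List B) {k} → (∀ a → length (f a) ≡ k) → ∀ l → length (concatMap f l) ≡ k * length l
length-concatMap f {k} h [] = sym (*-zeroʳ k)
length-concatMap f {k} h (a ∷ l) = begin
  length (f a ++ concatMap f l)         ≡⟨ length-++ (f a) ⟩
  length (f a) + length (concatMap f l) ≡⟨ cong₂ _+_ (h a) (length-concatMap f h l) ⟩
  k + k * length l                      ≡⟨ *-suc k (length l) ⟨
  k * suc (length l)                    ∎
  where open ≡-Reasoning

-- The default for an index out of range is arbitrary.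
childAt : List BDT → ℕ → BDT
childAt [] _ = leaf 0 0
childAt (c ∷ cs) zero = c
childAt (c ∷ cs) (suc m) = childAt cs m

childAt-At : ∀ {cs m c} → At cs m c → childAt cs m ≡ c
childAt-At here = refl
childAt-At (there p) = childAt-At p

module _ (xs : List ℕ) where
  open Augment xs

  -- The points charged to the greedy point (m , j) of a skeleton.  The pairs (m , m) pay for the
  -- points that ancestors add when the whole block ends.
  slots : ℕ → List BDT → ℕ × ℕ → List Point
  slots b cs (m , j) =
    (leftKey c , start d) ∷ (rightKey c , start d) ∷ (leftKey c , e) ∷ (rightKey c , e) ∷ []
    where
    c = childAt cs m
    d = childAt cs j
    e = if m ≡ᵇ j then b else end d

  start∈slots : ∀ {b cs m j c d y} → At cs m c → At cs j d → y ≡ leftKey c ⊎ y ≡ rightKey c →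
    (y , start d) ∈ slots b cs (m , j)
  start∈slots p q h with refl ← childAt-At p | refl ← childAt-At q with h
  ... | inj₁ refl = here refl
  ... | inj₂ refl = there (here refl)

  last∈slots : ∀ {b cs m c y} → At cs m c → y ≡ leftKey c ⊎ y ≡ rightKey c → (y , b) ∈ slots b cs (m , m)
  last∈slots {m = m} p h with refl ← childAt-At p with m ≡ᵇ m in eq
  ... | false = ⊥-elim (subst T eq (≡⇒≡ᵇ m m refl))
  ... | true with h
  ...   | inj₁ refl = there (there (here refl))
  ...   | inj₂ refl = there (there (there (here refl)))

  end∈slots : ∀ {b cs m j c d y} → At cs m c → At cs j d → m ≢ j → y ≡ leftKey c ⊎ y ≡ rightKey c →
    (y , end d) ∈ slots b cs (m , j)
  end∈slots {m = m} {j} p q m≢j h with refl ← childAt-At p | refl ← childAt-At q with m ≡ᵇ j in eq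
  ... | true = contradiction (≡ᵇ⇒≡ m j (subst T (sym eq) _)) m≢j
  ... | false with h
  ...   | inj₁ refl = there (there (here refl))
  ...   | inj₂ refl = there (there (there (here refl)))

  nodeCover : BDT → List Point
  nodeCover (leaf a b) = map (λ (m , j) → lookupD xs (a + m) , a + j) (greedyIndices (window xs a b))
  nodeCover (node a b cs) = concatMap (slots b cs) (greedyIndices (map (λ c → lookupD xs (start c)) cs))

  length-nodeCover : ∀ v → length (concatMap nodeCover (nodes v)) ≡ 4 * sumNonLeaf xs v + sumLeaf xs v
  length-nodeCoverAll : ∀ cs → length (concatMap nodeCover (nodesAll cs)) ≡ 4 * sumNonLeafAll xs cs + sumLeafAll xs cs
  length-nodeCover (leaf a b) = begin
    length (nodeCover (leaf a b) ++ [])        ≡⟨ cong length (++-identityʳ (nodeCover (leaf a b))) ⟩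
    length (nodeCover (leaf a b))              ≡⟨ length-map _ (greedyIndices (window xs a b)) ⟩
    length (greedyIndices (window xs a b))     ≡⟨ length-greedyIndices (window xs a b) ⟩
    Greedy (leafPerm xs a b)                   ∎
    where open ≡-Reasoning
  length-nodeCover (node a b cs) = begin
    length (nodeCover (node a b cs) ++ concatMap nodeCover (nodesAll cs))
      ≡⟨ length-++ (nodeCover (node a b cs)) ⟩
    length (nodeCover (node a b cs)) + length (concatMap nodeCover (nodesAll cs))
      ≡⟨ cong₂ _+_ (length-concatMap (slots b cs) (λ _ → refl) (greedyIndices zs)) (length-nodeCoverAll cs) ⟩
    4 * length (greedyIndices zs) + (4 * sumNonLeafAll xs cs + sumLeafAll xs cs)
      ≡⟨ cong (λ k → 4 * k + (4 * sumNonLeafAll xs cs + sumLeafAll xs cs)) (length-greedyIndices zs) ⟩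
    4 * Greedy (skeleton xs cs) + (4 * sumNonLeafAll xs cs + sumLeafAll xs cs)
      ≡⟨ +-assoc (4 * Greedy (skeleton xs cs)) (4 * sumNonLeafAll xs cs) (sumLeafAll xs cs) ⟨
    4 * Greedy (skeleton xs cs) + 4 * sumNonLeafAll xs cs + sumLeafAll xs cs
      ≡⟨ cong (_+ sumLeafAll xs cs) (*-distribˡ-+ 4 (Greedy (skeleton xs cs)) (sumNonLeafAll xs cs)) ⟨
    4 * (Greedy (skeleton xs cs) + sumNonLeafAll xs cs) + sumLeafAll xs cs ∎
    where
    open ≡-Reasoning
    zs = map (λ c → lookupD xs (start c)) cs
  length-nodeCoverAll [] = refl
  length-nodeCoverAll (c ∷ cs) = begin
    length (concatMap nodeCover (nodes c ++ nodesAll cs))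
      ≡⟨ cong length (concatMap-++ nodeCover (nodes c) (nodesAll cs)) ⟩
    length (concatMap nodeCover (nodes c) ++ concatMap nodeCover (nodesAll cs))
      ≡⟨ length-++ (concatMap nodeCover (nodes c)) ⟩
    length (concatMap nodeCover (nodes c)) + length (concatMap nodeCover (nodesAll cs))
      ≡⟨ cong₂ _+_ (length-nodeCover c) (length-nodeCoverAll cs) ⟩
    (4 * sumNonLeaf xs c + sumLeaf xs c) + (4 * sumNonLeafAll xs cs + sumLeafAll xs cs)
      ≡⟨ rearrange (sumNonLeaf xs c) (sumLeaf xs c) (sumNonLeafAll xs cs) (sumLeafAll xs cs) ⟩
    4 * (sumNonLeaf xs c + sumNonLeafAll xs cs) + (sumLeaf xs c + sumLeafAll xs cs) ∎
    where
    open ≡-Reasoning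
    rearrange : ∀ a b c d → (4 * a + b) + (4 * c + d) ≡ 4 * (a + c) + (b + d)
    rearrange = solve-∀

-- Origin of the output points of RGreedy, and shielding by finished blocks.

module Charge (xs : List ℕ) (distinct : Distinct xs) (𝒯 : BDT) (valid : ValidNode xs 𝒯) where
  open Augment xs
  open Valid xs
  open Path xs
  open Block xs distinct

  greedy⊆rgreedy : ∀ S t {p} → p ∈ greedyStep xs S t → p ∈ rgreedyStep xs 𝒯 S t
  greedy⊆rgreedy S t = foldl-⊆ (processPair xs t) (λ {S} {cp} → processPair-⊆ {t} {S} {cp}) (stepPairs t 𝒯)

  rgreedyStep-new : ∀ S t {y u} → (∀ {z v} → (z , v) ∈ S → v < t) → (y , u) ∈ rgreedyStep xs 𝒯 S t →
    (y , u) ∈ S ⊎ (u ≡ t × ((∃ λ v → (y , v) ∈ S) ⊎ y ≡ lookupD xs t))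
  rgreedyStep-new S t below i with processPairs⁻ below (stepPairs t 𝒯) i
  ... | inj₁ j = greedyStep⁻ xs S t below j
  ... | inj₂ (e , _ , _ , _ , v , _ , _ , j , _) = inj₂ (e , inj₁ (v , j))

  open Process xs distinct (rgreedyStep xs 𝒯) greedy⊆rgreedy rgreedyStep-new public

  Border : BDT → ℕ → Set
  Border w s = x s ≡ leftKey w ⊎ x s ≡ rightKey w

  IndexWing : ℕ → BDT → ℕ → ℕ → Set
  IndexWing t ci s u =
    (∀ {s′ u′} → O s′ u′ → u ≤ u′ → u′ < t → In ci s′ → x s′ ≤ x s → s′ ≡ s) ⊎
    (∀ {s′ u′} → O s′ u′ → u ≤ u′ → u′ < t → In ci s′ → x s ≤ x s′ → s′ ≡ s) ⊎
    Border ci s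

  -- `older` lies in the same column and in the same row as the added point, but strictly earlier;
  -- arguments about augmented points can thus go by induction on time.
  record Added (s t : ℕ) : Set where
    field
      {c p ci} : BDT
      {u}      : ℕ
      end≡     : end c ≡ t
      edge     : Edge 𝒯 c p
      ci∈      : ci ∈ children p
      inCi     : In ci s
      u<t      : u < t
      older    : O s u
      start≤u  : start c ≤ u
      wing     : IndexWing t ci s u

  node-val : ∀ {w} → w ∈ nodes 𝒯 → ValidNode xs w
  node-val i = proj₁ (node-valid 𝒯 valid i)

  edge-val : ∀ {c p} → Edge 𝒯 c p → ValidNode xs c
  edge-val e = node-val (Edge⇒node 𝒯 e)

  O-inv : ∀ {s t} → O s t → Touch O x t s ⊎ Added s t
  O-inv {s} {t} (s<n , t<n , i)
    with processPairs⁻ (out-below t) (stepPairs t 𝒯) (out-restrict (suc t) n (n<1+n t) i)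
  ... | inj₁ j = inj₁ (Gr⇒Touch s<n t<n j)
  ... | inj₂ (_ , c , p , ci , u , j , ci∈ , k , sc , l , r , w) with e , edge ← stepPairs⁻ 𝒯 j =
    inj₂ record
      { end≡ = e ; edge = edge ; ci∈ = ci∈ ; inCi = convex (child-valid (node-val (proj₁ edge)) ci∈) s<n l r
      ; u<t = u<t ; older = s<n , <-trans u<t t<n , out-mono (<⇒≤ t<n) k ; start≤u = sc ; wing = conv w }
    where
    u<t = out-below t k
    conv : Wing (out t) (leftKey ci) (rightKey ci) (end c) (x s) u → IndexWing t ci s u
    conv (inj₁ w) = inj₁ λ (s′<n , _ , i′) u≤ u′<t h le → distinct s′<n s<n
      (w (out-restrict t n u′<t i′) (leftKey-≤ h) le u≤ (≤-trans (<⇒≤ u′<t) (≤-reflexive (sym e))))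
    conv (inj₂ (inj₁ w)) = inj₂ (inj₁ λ (s′<n , _ , i′) u≤ u′<t h le → distinct s′<n s<n
      (w (out-restrict t n u′<t i′) le (≤-rightKey h) u≤ (≤-trans (<⇒≤ u′<t) (≤-reflexive (sym e)))))
    conv (inj₂ (inj₂ b)) = inj₂ (inj₂ b)

  O-touch : ∀ {s t} → s < n → t < n → Touch O x t s → O s t
  O-touch s<n t<n h = Gr⇒O s<n t<n (Touch⇒Gr s<n t<n h)

  O-self : ∀ {s} → s < n → O s s
  O-self s<n = O-touch s<n s<n (inj₁ refl)

  -- The topmost point of a border column is always in the topwing, so the augmentation at `end c`
  -- copies it to the last line.
  O-border : ∀ {c p ci s u} → Edge 𝒯 c p → ci ∈ children p → In ci s → Border ci s → O s u → In c u → O s (end c)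
  O-border {c} {p} {ci} {s} {u} edge ci∈ h b o@(s<n , u<n , i) hu with m≤n⇒m<n∨m≡n (≤end hu)
  ... | inj₂ refl = o
  ... | inj₁ u<e = s<n , e<n , out-mono e<n
      (processPairs⁺ {c = c} {p} {ci} (stepPairs⁺ 𝒯 valid edge) ci∈ (leftKey-≤ h) (≤-rightKey h) b
        (⊆greedyStep xs (out (end c)) (end c) (out-restrict (end c) n u<e i)) (start≤ hu) (≤end hu))
    where e<n = In⇒<n (edge-val edge) (valid-≤ (edge-val edge) , ≤-refl)

  -- The region is the diagonal one, `w` itself, and the point that gets copied is the access at
  -- `s`.
  border-end : ∀ {w p s} → Edge 𝒯 w p → In w s → Border w s → O s (end w)
  border-end e h b = O-border e (proj₂ e) h b (O-self (In⇒<n (edge-val e) h)) h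

  -- The border columns are touched when w ends; from then on they shield the interior columns both from
  -- accesses and from the corners of larger regions.
  interior : ∀ {w p} → Edge 𝒯 w p → ∀ {t} → Acc _<_ t → ∀ {s} → end w < t → O s t → In w s → Border w s
  interior {w} e {t} (acc rec) {s} e<t o hs with O-inv o
  ... | inj₁ (inj₁ refl) = contradiction (≤end hs) (<⇒≱ e<t)
  ... | inj₁ (inj₂ (τ , τ<t , oτ , vis)) with end w <? τ
  ...   | yes e<τ = interior e (rec τ<t) e<τ oτ hs
  -- The witness `τ` is not later than `end w`. The border column facing the access was touched at
  -- `end w` and lies between the access and `s`, so visibility makes it column `s`.
  ...   | no e≮τ with outside (edge-val e) (proj₁ (proj₂ o)) (λ h → <⇒≱ e<t (≤end h))
  ...     | inj₁ lt with l , hl , el ← leftKey-attained (edge-val e)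
    with refl ← vis (border-end e hl (inj₁ el)) e<t (≮⇒≥ e≮τ)
      (inj₁ (<⇒≤ (<-≤-trans lt (≤-reflexive (sym el))) , ≤-trans (≤-reflexive el) (leftKey-≤ hs))) = inj₁ el
  ...     | inj₂ gt with r , hr , er ← rightKey-attained (edge-val e)
    with refl ← vis (border-end e hr (inj₂ er)) e<t (≮⇒≥ e≮τ)
      (inj₂ (≤-trans (≤-rightKey hs) (≤-reflexive (sym er)) , <⇒≤ (≤-<-trans (≤-reflexive er) gt))) = inj₂ er
  interior {w} e {t} (acc rec) {s} e<t o hs | inj₂ add with end w <? Added.u add
  ...   | yes e<u = interior e (rec (Added.u<t add)) e<u (Added.older add) hs
  ...   | no e≮u with laminar 𝒯 valid (Added.edge add) (Edge⇒node 𝒯 e)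
            (Added.start≤u add , ≤-trans (<⇒≤ (Added.u<t add)) (≤-reflexive (sym (Added.end≡ add))))
            (≤-trans (start≤ hs) (O-≤ (Added.older add)) , ≮⇒≥ e≮u)
  ...     | inj₂ p⊑w = contradiction
              (≤-trans (≤-reflexive (sym (Added.end≡ add)))
                (≤-trans (end-⊑ (child-⊑ (node-val (proj₁ (Added.edge add))) (proj₂ (Added.edge add)))) (end-⊑ p⊑w)))
              (<⇒≱ e<t)
  -- Both `ci` and `c` contain `s`, so they are the same child, and the region is the block `c`,
  -- which contains all of `w`. The borders of `w` then contradict an empty corner rectangle, unless
  -- `s` is one of them.
  ...     | inj₁ w⊑c with refl ← children-≡ (node-val (proj₁ (Added.edge add))) (Added.ci∈ add)
              (proj₂ (Added.edge add)) (Added.inCi add) (In-⊑ w⊑c hs)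
    with l , hl , el ← leftKey-attained (edge-val e) | r , hr , er ← rightKey-attained (edge-val e)
    with Added.wing add
  ...       | inj₁ empty with refl ← empty (border-end e hl (inj₁ el)) (≮⇒≥ e≮u) e<t (In-⊑ w⊑c hl)
                (≤-trans (≤-reflexive el) (leftKey-≤ hs)) = inj₁ el
  ...       | inj₂ (inj₁ empty) with refl ← empty (border-end e hr (inj₂ er)) (≮⇒≥ e≮u) e<t (In-⊑ w⊑c hr)
                (≤-trans (≤-rightKey hs) (≤-reflexive (sym er))) = inj₂ er
  ...       | inj₂ (inj₂ (inj₁ b)) = inj₁ (≤-antisym
                (≤-trans (≤-reflexive b) (≤-trans (leftKey-≤ (In-⊑ w⊑c hl)) (≤-reflexive el))) (leftKey-≤ hs))
  ...       | inj₂ (inj₂ (inj₂ b)) = inj₂ (≤-antisym (≤-rightKey hs)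
                (≤-trans (≤-reflexive (sym er)) (≤-trans (≤-rightKey (In-⊑ w⊑c hr)) (≤-reflexive (sym b)))))

  -- A node that ends at `t` is strictly inside `w`, which is still running; so its parent is inside
  -- `w` too, and augmentation stays within the columns of `w`.
  local-touch : ∀ {w p s t} → Edge 𝒯 w p → In w t → t < end w → ¬ In w s → O s t → Touch O x t s
  local-touch e ht t<e ¬hs o with O-inv o
  ... | inj₁ touch = touch
  ... | inj₂ add with laminar 𝒯 valid (Added.edge add) (Edge⇒node 𝒯 e)
          (valid-≤′ , ≤-reflexive (sym (Added.end≡ add))) ht
    where valid-≤′ = ≤-trans (Added.start≤u add) (<⇒≤ (Added.u<t add))
  ...   | inj₁ w⊑c = contradiction (≤-trans (end-⊑ w⊑c) (≤-reflexive (Added.end≡ add))) (<⇒≱ t<e)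
  ...   | inj₂ p⊑w = contradiction
          (In-⊑ p⊑w (In-⊑ (child-⊑ (node-val (proj₁ (Added.edge add))) (Added.ci∈ add)) (Added.inCi add))) ¬hs

  -- Nearest columns outside a block.

  Blocked : BDT → ℕ → ℕ → Set
  Blocked w s y = (x s < x y × x y < leftKey w) ⊎ (rightKey w < x y × x y < x s)

  leftKey-≤-rightKey : ∀ {w} → ValidNode xs w → leftKey w ≤ rightKey w
  leftKey-≤-rightKey {w} v = ≤-trans (leftKey-≤ h) (≤-rightKey h)
    where
    h : In w (start w)
    h = ≤-refl , valid-≤ v

  Nearest : BDT → ℕ → Set
  Nearest w s = ∀ {y} → y < start w → ¬ Blocked w s y

  -- No column of `w` is touched before `w` starts, so only a blocker could hide `s` from the first
  -- access. The witness is the access of `s` itself.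
  nearest-touch : ∀ {w s} → ValidNode xs w → s < start w → Nearest w s → Touch O x (start w) s
  nearest-touch {w} {s} val s<a near = inj₂ (s , s<a , O-self (<-trans s<a (In⇒<n val ha)) , λ o u<a _ →
      empty (proj₁ o) (≤-<-trans (O-≤ o) u<a))
    where
    ha : In w (start w)
    ha = ≤-refl , valid-≤ val
    empty : ∀ {s′} → s′ < n → s′ < start w → Between (x (start w)) (x s) (x s′) → s′ ≡ s
    empty {s′} s′<n s′<a btw with outside val s′<n (λ h → <⇒≱ s′<a (start≤ h)) | btw
    ... | inj₁ lt | inj₁ (a≤ , _) = contradiction (≤-trans (leftKey-≤ ha) a≤) (<⇒≱ lt)
    ... | inj₂ gt | inj₂ (_ , ≤a) = contradiction (≤-trans ≤a (≤-rightKey ha)) (<⇒≱ gt)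
    ... | inj₁ lt | inj₂ (s≤ , _) = distinct s′<n (<-trans s<a (In⇒<n val ha))
            (≤-antisym (≮⇒≥ λ h → near s′<a (inj₁ (h , lt))) s≤)
    ... | inj₂ gt | inj₁ (_ , ≤s) = distinct s′<n (<-trans s<a (In⇒<n val ha))
            (≤-antisym ≤s (≮⇒≥ λ h → near s′<a (inj₂ (gt , h))))

  nearest-blocker : ∀ {w s y} → ValidNode xs w → y < start w → Blocked w s y →
    ∃ λ r → r < start w × Blocked w s r × Nearest w r
  nearest-blocker {w} {s} val y<a (inj₁ b)
    with r , r<a , (s<r , r<l) , best ← extremum {P = λ i → x s < x i × x i < leftKey w} {_≼_ = λ i j → x i ≤ x j}
      (λ i → x s <? x i ×-dec x i <? leftKey w) (λ i j → ≤-total (x i) (x j)) ≤-trans y<a b =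
    r , r<a , inj₁ (s<r , r<l) , λ where
      y′<a (inj₁ (r<y′ , y′<l)) → <⇒≱ r<y′ (best y′<a (<-trans s<r r<y′ , y′<l))
      y′<a (inj₂ (r<y′ , y′<r)) → <⇒≱ (<-trans r<y′ (<-trans y′<r r<l)) (leftKey-≤-rightKey val)
  nearest-blocker {w} {s} val y<a (inj₂ b)
    with r , r<a , (g<r , r<s) , best ← extremum {P = λ i → rightKey w < x i × x i < x s} {_≼_ = λ i j → x j ≤ x i}
      (λ i → rightKey w <? x i ×-dec x i <? x s) (λ i j → ≤-total (x j) (x i)) (λ p q → ≤-trans q p) y<a b =
    r , r<a , inj₂ (g<r , r<s) , λ where
      y′<a (inj₂ (g<y′ , y′<r)) → <⇒≱ y′<r (best y′<a (g<y′ , <-trans y′<r r<s))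
      y′<a (inj₁ (r<y′ , y′<l)) → <⇒≱ (<-trans g<r (<-trans r<y′ y′<l)) (leftKey-≤-rightKey val)

  -- The nearest blocker is touched at the start of w and hides everything behind it for the rest of w.
  touch-nearest : ∀ {w p} → Edge 𝒯 w p → ∀ {t} → Acc _<_ t → ∀ {s} → start w < t → t ≤ end w →
    Touch O x t s → ¬ In w s → Nearest w s
  touch-nearest e _ a<t t≤e (inj₁ refl) ¬hs _ _ = ¬hs (<⇒≤ a<t , t≤e)
  touch-nearest {w} e {t} (acc rec) {s} a<t t≤e (inj₂ (τ , τ<t , o , vis)) ¬hs y<a blocked with start w <? τ
  -- `w` is still running at `τ`, so the touch at `τ` is greedy as well, and the induction
  -- hypothesis applies to it.
  ... | yes a<τ = touch-nearest e (rec τ<t) a<τ (<⇒≤ τ<e)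
                    (local-touch e (<⇒≤ a<τ , <⇒≤ τ<e) τ<e ¬hs o) ¬hs y<a blocked
    where τ<e = <-≤-trans τ<t t≤e
  ... | no a≮τ with r , r<a , blk , near ← nearest-blocker (edge-val e) y<a blocked = irrefl blk
    (vis (O-touch (<-trans r<a a<n) a<n (nearest-touch (edge-val e) r<a near)) a<t (≮⇒≥ a≮τ) (between blk))
    where
    a<n = In⇒<n (edge-val e) (≤-refl , valid-≤ (edge-val e))
    ht : In w t
    ht = <⇒≤ a<t , t≤e
    between : ∀ {r} → Blocked w s r → Between (x t) (x s) (x r)
    between (inj₁ (s<r , r<l)) = inj₂ (<⇒≤ s<r , <⇒≤ (<-≤-trans r<l (leftKey-≤ ht)))
    between (inj₂ (g<r , r<s)) = inj₁ (<⇒≤ (≤-<-trans (≤-rightKey ht) g<r) , <⇒≤ r<s)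
    irrefl : ∀ {r} → Blocked w s r → r ≢ s
    irrefl (inj₁ (lt , _)) refl = <-irrefl refl lt
    irrefl (inj₂ (_ , lt)) refl = <-irrefl refl lt

  -- The rows of a node compared with Greedy on its skeleton.

  module Skeleton {a b cs} (v∈ : node a b cs ∈ nodes 𝒯) where

    v : BDT
    v = node a b cs

    zs : List ℕ
    zs = map (λ c → lookupD xs (start c)) cs

    G : ℕ → ℕ → Set
    G m j = (m , j) ∈ greedyIndices zs

    private
      vs : ValidAll xs cs
      vs = proj₁ (proj₂ (proj₂ (node-val v∈)))

      con : Consecutive a b cs
      con = proj₂ (proj₂ (proj₂ (node-val v∈)))

      edge : ∀ {m c} → At cs m c → Edge 𝒯 c v
      edge p = v∈ , At⇒∈ p

      val : ∀ {m c} → At cs m c → ValidNode xs c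
      val p = validAll-At vs p

      sub : ∀ {m c} → At cs m c → c ⊑ v
      sub p = child-⊑ (node-val v∈) (At⇒∈ p)

      first : ∀ {m c} → At cs m c → In c (start c)
      first p = ≤-refl , valid-≤ (val p)

      same : ∀ {m j c d t} → At cs m c → At cs j d → In c t → In d t → m ≡ j
      same p q = consecutive-At-≡ vs con p q

      before : ∀ {m j c d} → At cs m c → At cs j d → m < j → end c < start d
      before = consecutive-< cs vs con

      cover : ∀ {t} → In v t → ∃ λ m → ∃ λ c → At cs m c × In c t
      cover (h₁ , h₂) = consecutive-cover cs con h₁ h₂

      index-< : ∀ {m j c d t} → At cs m c → At cs j d → In c t → t < start d → m < j
      index-< {m} {j} p q h t<d with <-cmp m j
      ... | tri< lt _ _ = lt
      ... | tri≈ _ refl _ with refl ← At-functional p q = contradiction (start≤ h) (<⇒≱ t<d)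
      ... | tri> _ _ gt = contradiction (≤-trans (valid-≤ (val q)) (<⇒≤ (<-≤-trans (before q p gt) (start≤ h)))) (<⇒≱ t<d)

      index-≤ : ∀ {m j c d t} → At cs m c → At cs j d → In d t → end c ≤ t → m ≤ j
      index-≤ p q h e≤t = ≮⇒≥ λ j<m → <⇒≱ (before q p j<m) (≤-trans (valid-≤ (val p)) (≤-trans e≤t (≤end h)))

      end-mono : ∀ {m j c d} → At cs m c → At cs j d → m ≤ j → end c ≤ end d
      end-mono p q m≤j with m≤n⇒m<n∨m≡n m≤j
      ... | inj₁ lt = ≤-trans (<⇒≤ (before p q lt)) (valid-≤ (val q))
      ... | inj₂ refl with refl ← At-functional p q = ≤-refl

      z≡ : ∀ {m c} → At cs m c → lookupD zs m ≡ x (start c)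
      z≡ = lookupD-At (λ c → lookupD xs (start c))

      length-zs : length zs ≡ length cs
      length-zs = length-map _ cs

      at : ∀ {m} → m < length zs → ∃ λ c → At cs m c
      at h = At-lookup (subst (_ <_) length-zs h)

      <zs : ∀ {m c} → At cs m c → m < length zs
      <zs p = subst (_ <_) (sym length-zs) (At-< p)

    zs-distinct : Distinct zs
    zs-distinct hm hj e with c , p ← at hm | d , q ← at hj =
      same p q (first p) (subst (In d) (sym start≡) (first q))
      where start≡ = distinct (In⇒<n (val p) (first p)) (In⇒<n (val q) (first q)) (trans (sym (z≡ p)) (trans e (z≡ q)))

    separated : ∀ {m j c d s₁ s₂ r₁ r₂} → At cs m c → At cs j d → m ≢ j →
      In c s₁ → In c s₂ → In d r₁ → In d r₂ → x s₁ ≤ x r₁ → x s₂ < x r₂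
    separated p q m≢j = separate (val p) (val q) (λ h h′ → m≢j (same p q h h′))

    z-mono : ∀ {m j c d s r} → At cs m c → At cs j d → In c s → In d r → x s ≤ x r → lookupD zs m ≤ lookupD zs j
    z-mono {m} {j} p q hs hr le with m ≟ j
    ... | yes refl = ≤-refl
    ... | no m≢j = subst₂ _≤_ (sym (z≡ p)) (sym (z≡ q)) (<⇒≤ (separated p q m≢j hs (first p) hr (first q) le))

    x-mono : ∀ {m j c d s r} → At cs m c → At cs j d → m ≢ j → In c s → In d r → lookupD zs m ≤ lookupD zs j → x s ≤ x r
    x-mono p q m≢j hs hr le = <⇒≤ (separated p q m≢j (first p) hs (first q) hr (subst₂ _≤_ (z≡ p) (z≡ q) le))

    Touched : BDT → BDT → Set
    Touched c d = ∃ λ s → ∃ λ t → In c s × In d t × O s t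

    -- On the diagonal a border of the child serves. Elsewhere `c` has ended before row `d` starts,
    -- so the touched column is a border of `c` and is carried to the last line of the row.
    touched-end : ∀ {m j c d} → At cs m c → At cs j d → Touched c d → ∃ λ s → In c s × O s (end d)
    touched-end {m} {j} p q (s , t , hs , ht , o) with m ≟ j
    ... | yes refl with refl ← At-functional p q with l , hl , el ← leftKey-attained (val p) =
      l , hl , border-end (edge p) hl (inj₁ el)
    ... | no m≢j = s , hs , O-border (edge q) (At⇒∈ p) hs
        (interior (edge p) (<-wellFounded t) (<-≤-trans (before p q m<j) (start≤ ht)) o hs) o ht
      where
      m<j : m < j
      m<j = ≤∧≢⇒< (≮⇒≥ λ j<m → <⇒≱ (before q p j<m) (≤-trans (start≤ hs) (≤-trans (O-≤ o) (≤end ht)))) m≢j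

    StartTouch : BDT → BDT → Set
    StartTouch c d = ∃ λ s → In c s × Touch O x (start d) s

    -- When d is not the last child, no ancestor of d ends with it, so a point of the region is
    -- either a greedy one or an augmentation of an older point of the same region.
    touched-start : ∀ {m j c d} → At cs m c → At cs j d → m ≢ j → end d < b → ∀ {t} → Acc _<_ t → ∀ {s} →
      In c s → In d t → O s t → StartTouch c d
    touched-start {c = c} {d} p q m≢j d<b {t} (acc rec) {s} hs ht o with O-inv o
    ... | inj₂ add with laminar 𝒯 valid (edge q) (Edge⇒node 𝒯 (Added.edge add)) ht
            (≤-trans (Added.start≤u add) (<⇒≤ (Added.u<t add)) , ≤-reflexive (sym (Added.end≡ add)))
    ...   | inj₂ v⊑ = contradiction (≤-trans (end-⊑ v⊑) (≤-trans (≤-reflexive (Added.end≡ add)) (≤end ht))) (<⇒≱ d<b)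
    ...   | inj₁ ⊑d = touched-start p q m≢j d<b (rec (Added.u<t add)) hs
              (≤-trans (start-⊑ ⊑d) (Added.start≤u add) , ≤-trans (<⇒≤ (Added.u<t add)) (≤end ht)) (Added.older add)
    touched-start {c = c} {d} p q m≢j d<b {t} (acc rec) {s} hs ht o | inj₁ touch with m≤n⇒m<n∨m≡n (start≤ ht)
    ... | inj₂ refl = s , hs , touch
    -- A greedy touch inside the row can only be at a nearest column, and such a column was already
    -- touched when the row started.
    ... | inj₁ d<t = s , hs , nearest-touch (val q) s<d (touch-nearest (edge q) (<-wellFounded t) d<t (≤end ht) touch ¬hs)
      where
      ¬hs : ¬ In d s
      ¬hs h = m≢j (same p q hs h)
      s<d : s < start d
      s<d = ≰⇒> λ d≤s → ¬hs (d≤s , ≤-trans (O-≤ o) (≤end ht))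

    Agree : ℕ → Set
    Agree j = ∀ {m c d} → At cs m c → At cs j d → m ≢ j → (StartTouch c d → G m j) × (G m j → StartTouch c d)

    module _ {j} (agree : ∀ {i} → i < j → Agree i) {d} (q : At cs j d) where

      private
        d∋ = first q
        t₀<n = In⇒<n (val q) d∋

      touched⇒G : ∀ {m c i d′} → At cs m c → At cs i d′ → i < j → Touched c d′ → G m i
      touched⇒G {m} {i = i} p r i<j (s , t , hs , ht , o) with m ≟ i
      ... | yes refl = touch-greedyIndices zs zs-distinct (<zs p) (<zs r) (inj₁ refl)
      -- Row `d` comes later, so row `d′` ends strictly before `b`.
      ... | no m≢i = proj₁ (agree i<j p r m≢i) (touched-start p r m≢i
              (<-≤-trans (before r q i<j) (≤-trans (valid-≤ (val q)) (end-⊑ (sub q)))) (<-wellFounded t) hs ht o)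

      G⇒touched : ∀ {m c i d′} → At cs m c → At cs i d′ → i < j → G m i → Touched c d′
      G⇒touched {m} {c} {i} {d′} p r i<j g with m ≟ i
      ... | yes refl with refl ← At-functional p r = start c , start c , first p , first p , O-self (In⇒<n (val p) (first p))
      ... | no m≢i with s , hs , touch ← proj₂ (agree i<j p r m≢i) g =
        s , start d′ , hs , first r , O-touch (In⇒<n (val p) hs) (In⇒<n (val r) (first r)) touch

      startTouch⇒G : ∀ {m c} → At cs m c → m ≢ j → StartTouch c d → G m j
      startTouch⇒G p m≢j (s , hs , inj₁ refl) = contradiction (same p q hs d∋) m≢j
      startTouch⇒G {m} {c} p m≢j (s , hs , inj₂ (τ , τ<t₀ , o , vis))
        with i , d′ , r , hτ ← cover (≤-trans (start-⊑ (sub p)) (≤-trans (start≤ hs) (O-≤ o)) ,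
               ≤-trans (<⇒≤ τ<t₀) (≤-trans (valid-≤ (val q)) (end-⊑ (sub q))))
        with i<j ← index-< r q hτ τ<t₀ =
        touch-greedyIndices zs zs-distinct (<zs p) (<zs q)
          (inj₂ (i , i<j , touched⇒G p r i<j (s , τ , hs , hτ , o) , empty))
        where
        empty : ∀ {m′ u} → G m′ u → u < j → i ≤ u → Between (lookupD zs j) (lookupD zs m) (lookupD zs m′) → m′ ≡ m
        empty {m′} {u} g u<j i≤u btw with m′ ≟ m
        ... | yes e = e
        ... | no m′≢m
          with m′<k , u<k ← greedyIndices-bound zs zs-distinct g
          with c′ , p′ ← at m′<k | d″ , r″ ← at u<k
          -- Moving the obstacle to the end of its row makes it no earlier than `τ`, even if `τ`
          -- lies in the same row. This is where the skeleton would fail without augmentation.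
          with s′ , hs′ , o′ ← touched-end p′ r″ (G⇒touched p′ r″ u<j g)
          with e<t₀ ← before r″ q u<j =
          same p′ p hs′ (subst (In c) (sym (vis o′ e<t₀ (≤-trans (≤end hτ) (end-mono r r″ i≤u)) (lift btw))) hs)
          where
          m′≢j : m′ ≢ j
          m′≢j refl with refl ← At-functional p′ q = <⇒≱ e<t₀ (≤-trans (start≤ hs′) (O-≤ o′))
          lift : Between (lookupD zs j) (lookupD zs m) (lookupD zs m′) → Between (x (start d)) (x s) (x s′)
          lift (inj₁ (h₁ , h₂)) = inj₁ (x-mono q p′ (m′≢j ∘ sym) d∋ hs′ h₁ , x-mono p′ p m′≢m hs′ hs h₂)
          lift (inj₂ (h₁ , h₂)) = inj₂ (x-mono p p′ (m′≢m ∘ sym) hs hs′ h₁ , x-mono p′ q m′≢j hs′ d∋ h₂)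

      G⇒startTouch : ∀ {m c} → At cs m c → m ≢ j → G m j → StartTouch c d
      G⇒startTouch {m} {c} p m≢j g with greedyIndices-touch zs zs-distinct g
      ... | inj₁ m≡j = contradiction m≡j m≢j
      ... | inj₂ (τ₀ , τ₀<j , g₀ , vis)
        -- The witness row is the last one before `j` in which `c` is touched, so an obstacle inside
        -- `c` itself can only lie in this row.
        with τ , τ<j , gτ , latest ← extremum {P = G m} {_≼_ = _≤_} (λ i → (m , i) ∈ₚ? greedyIndices zs)
               ≤-total ≤-trans τ₀<j g₀
        with d′ , r ← at (proj₂ (greedyIndices-bound zs zs-distinct gτ))
        with s₀ , hs₀ , o₀ ← touched-end p r (G⇒touched p r τ<j gτ) = choose (≤-total (x s₀) (x (start d)))
        where
        e<t₀ = before r q τ<j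

        In? : ∀ s → Dec (In c s)
        In? s = map′ (λ (h₁ , h₂) → h₁ , h₂) (λ h → start≤ h , ≤end h) (start c ≤? s ×-dec s ≤? end c)

        visible : ∀ {s} → In c s → O s (end d′) →
          (∀ {s′} → In c s′ → O s′ (end d′) → Between (x (start d)) (x s) (x s′) → s′ ≡ s) → StartTouch c d
        visible {s} hs o best = s , hs , inj₂ (end d′ , e<t₀ , o , empty)
          where
          In-v : ∀ {s′} → s′ < n → Between (x (start d)) (x s) (x s′) → In v s′
          In-v s′<n (inj₁ (h₁ , h₂)) = convex (node-val v∈) s′<n
            (≤-trans (leftKey-≤ (In-⊑ (sub q) d∋)) h₁) (≤-trans h₂ (≤-rightKey (In-⊑ (sub p) hs)))
          In-v s′<n (inj₂ (h₁ , h₂)) = convex (node-val v∈) s′<n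
            (≤-trans (leftKey-≤ (In-⊑ (sub p) hs)) h₁) (≤-trans h₂ (≤-rightKey (In-⊑ (sub q) d∋)))
          z-between : ∀ {m′ c′ s′} → At cs m′ c′ → In c′ s′ → Between (x (start d)) (x s) (x s′) →
            Between (lookupD zs j) (lookupD zs m) (lookupD zs m′)
          z-between p′ hs′ (inj₁ (h₁ , h₂)) = inj₁ (z-mono q p′ d∋ hs′ h₁ , z-mono p′ p hs′ hs h₂)
          z-between p′ hs′ (inj₂ (h₁ , h₂)) = inj₂ (z-mono p p′ hs hs′ h₁ , z-mono p′ q hs′ d∋ h₂)
          empty : ∀ {s′ u} → O s′ u → u < start d → end d′ ≤ u → Between (x (start d)) (x s) (x s′) → s′ ≡ s
          empty {s′} {u} o′ u<t₀ e≤u btw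
            with m′ , c′ , p′ , hs′ ← cover (In-v (proj₁ o′) btw)
            with i , d″ , r″ , hu ← cover {u} (≤-trans (start-⊑ (sub p)) (≤-trans (start≤ hs) (≤-trans (O-≤ o) e≤u)) ,
                   ≤-trans (<⇒≤ u<t₀) (≤-trans (valid-≤ (val q)) (end-⊑ (sub q))))
            with i<j ← index-< r″ q hu u<t₀
            with g′ ← touched⇒G p′ r″ i<j (s′ , u , hs′ , hu , o′)
            -- Skeleton visibility forces the obstacle into `c`, `latest` forces it into row `τ`,
            -- and the time bound onto the last line of that row, where `s` was chosen nearest to
            -- `d`.
            with refl ← vis g′ i<j (≤-trans (latest τ₀<j g₀) (index-≤ r r″ hu e≤u)) (z-between p′ hs′ btw)
            with refl ← At-functional p p′
            with refl ← ≤-antisym (latest i<j g′) (index-≤ r r″ hu e≤u)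
            with refl ← At-functional r r″
            with refl ← ≤-antisym (≤end hu) e≤u = best hs′ o′ btw

        choose : x s₀ ≤ x (start d) ⊎ x (start d) ≤ x s₀ → StartTouch c d
        choose (inj₁ le)
          with s , _ , (hs , o) , best ← extremum {P = λ s → In c s × O s (end d′)} {_≼_ = λ i j → x i ≤ x j}
            (λ s → In? s ×-dec O? s (end d′)) (λ i j → ≤-total (x i) (x j)) ≤-trans (proj₁ o₀) (hs₀ , o₀) =
          visible hs o λ where
            hs′ o′ (inj₁ (h₁ , h₂)) → contradiction (≤-trans h₁ h₂) (<⇒≱ (separated p q m≢j hs₀ hs d∋ d∋ le))
            hs′ o′ (inj₂ (h₁ , h₂)) → distinct (proj₁ o′) (proj₁ o) (≤-antisym (best (proj₁ o′) (hs′ , o′)) h₁)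
        choose (inj₂ ge)
          with s , _ , (hs , o) , best ← extremum {P = λ s → In c s × O s (end d′)} {_≼_ = λ i j → x j ≤ x i}
            (λ s → In? s ×-dec O? s (end d′)) (λ i j → ≤-total (x j) (x i)) (λ h h′ → ≤-trans h′ h) (proj₁ o₀) (hs₀ , o₀) =
          visible hs o λ where
            hs′ o′ (inj₁ (h₁ , h₂)) → distinct (proj₁ o′) (proj₁ o) (≤-antisym h₂ (best (proj₁ o′) (hs′ , o′)))
            hs′ o′ (inj₂ (h₁ , h₂)) → contradiction (≤-trans h₁ h₂) (<⇒≱ (separated q p (m≢j ∘ sym) d∋ d∋ hs₀ hs ge))

    -- `StartTouch` comes from the run of RGreedy and `G` from that of Greedy. Both obey the same
    -- rule, and each direction uses the equivalence only for earlier rows.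
    agree : ∀ {j} → Acc _<_ j → Agree j
    agree (acc rec) p q m≢j =
      startTouch⇒G (λ i<j → agree (rec i<j)) q p m≢j , G⇒startTouch (λ i<j → agree (rec i<j)) q p m≢j

  -- The inside of a leaf block compared with Greedy.

  module Leaf {a b} (q∈ : leaf a b ∈ nodes 𝒯) where

    zs : List ℕ
    zs = window xs a b

    G : ℕ → ℕ → Set
    G m j = (m , j) ∈ greedyIndices zs

    private
      Q : BDT
      Q = leaf a b

      k : ℕ
      k = suc b ∸ a

      length-zs : length zs ≡ k
      length-zs = trans (length-map x (range a b)) (trans (length-map (a +_) (upTo k)) (length-upTo k))

      z≡ : ∀ {m} → m < k → lookupD zs m ≡ x (a + m)
      z≡ {m} h = begin
        lookupD (map x (range a b)) m     ≡⟨ lookupD-map x (range a b) (subst (m <_) (sym (trans (length-map (a +_) (upTo k)) (length-upTo k))) h) ⟩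
        x (lookupD (range a b) m)         ≡⟨ cong x (lookupD-map (a +_) (upTo k) (subst (m <_) (sym (length-upTo k)) h)) ⟩
        x (a + lookupD (upTo k) m)        ≡⟨ cong (λ i → x (a + i)) (lookupD-applyUpTo id k h) ⟩
        x (a + m)                         ∎
        where open ≡-Reasoning

    inQ : ∀ {m} → m < k → In Q (a + m)
    inQ h with h₁ , h₂ ← range⁻ a b (∈-map⁺ (a +_) (∈-upTo⁺ h)) = h₁ , h₂

    position : ∀ {s} → In Q s → ∃ λ m → m < k × s ≡ a + m
    position {s} (h₁ , h₂) = s ∸ a , ∸-monoˡ-< (s≤s h₂) h₁ , sym (m+[n∸m]≡n h₁)

    private
      <n : ∀ {m} → m < k → a + m < n
      <n h = In⇒<n (node-val q∈) (inQ h)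

      <zs : ∀ {m} → m < k → m < length zs
      <zs = subst (_ <_) (sym length-zs)

      zs< : ∀ {m} → m < length zs → m < k
      zs< = subst (_ <_) length-zs

    zs-distinct : Distinct zs
    zs-distinct hm hj e = +-cancelˡ-≡ a _ _ (distinct (<n (zs< hm)) (<n (zs< hj))
      (trans (sym (z≡ (zs< hm))) (trans e (z≡ (zs< hj)))))

    -- Augmentation at `t` comes from a node ending at `t`. Any node that contains a time of the
    -- leaf contains the whole leaf, so `t` is its last time.
    leaf-touch : ∀ {s t} → In Q t → O s t → t ≡ b ⊎ Touch O x t s
    leaf-touch ht o with O-inv o
    ... | inj₁ touch = inj₂ touch
    ... | inj₂ add = inj₁ (≤-antisym (≤end ht) (≤-trans (end-⊑ (leaf-⊑ 𝒯 valid q∈ (Edge⇒node 𝒯 (Added.edge add)) ht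
            (≤-trans (Added.start≤u add) (<⇒≤ (Added.u<t add)) , ≤-reflexive (sym (Added.end≡ add)))))
            (≤-reflexive (Added.end≡ add))))

    Agree : ℕ → Set
    Agree j = ∀ {m} → m < k → j < k → (Touch O x (a + j) (a + m) → G m j) × (G m j → Touch O x (a + j) (a + m))

    -- By convexity only columns of the leaf lie between two of its columns. They are empty before
    -- time `a` and touched by Greedy alone before time `b`, so the rest of the output cannot
    -- interfere.
    agree : ∀ {j} → Acc _<_ j → Agree j
    agree {j} (acc rec) {m} m<k j<k = fwd , bwd
      where
      O⇒G : ∀ {m i} → m < k → i < j → O (a + m) (a + i) → G m i
      O⇒G m<k i<j o with leaf-touch (inQ (<-trans i<j j<k)) o
      ... | inj₁ e = contradiction e (<⇒≢ (<-≤-trans (+-monoʳ-< a i<j) (≤end (inQ j<k))))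
      ... | inj₂ touch = proj₁ (agree (rec i<j) m<k (<-trans i<j j<k)) touch

      G⇒O : ∀ {m i} → i < j → G m i → O (a + m) (a + i)
      G⇒O i<j g with m<k ← zs< (proj₁ (greedyIndices-bound zs zs-distinct g)) =
        O-touch (<n m<k) (<n (<-trans i<j j<k)) (proj₂ (agree (rec i<j) m<k (<-trans i<j j<k)) g)

      z-between : ∀ {m′} → m′ < k → Between (x (a + j)) (x (a + m)) (x (a + m′)) ≡
        Between (lookupD zs j) (lookupD zs m) (lookupD zs m′)
      z-between m′<k rewrite z≡ j<k | z≡ m<k | z≡ m′<k = refl

      fwd : Touch O x (a + j) (a + m) → G m j
      fwd (inj₁ e) = touch-greedyIndices zs zs-distinct (<zs m<k) (<zs j<k) (inj₁ (+-cancelˡ-≡ a m j e))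
      fwd (inj₂ (τ , τ<t , o , vis))
        with i , i<k , refl ← position (≤-trans (m≤m+n a m) (O-≤ o) , ≤-trans (<⇒≤ τ<t) (≤end (inQ j<k)))
        with i<j ← +-cancelˡ-< a i j τ<t =
        touch-greedyIndices zs zs-distinct (<zs m<k) (<zs j<k) (inj₂ (i , i<j , O⇒G m<k i<j o ,
          λ g u<j i≤u btw → +-cancelˡ-≡ a _ _ (vis (G⇒O u<j g) (+-monoʳ-< a u<j) (+-monoʳ-≤ a i≤u)
            (subst id (sym (z-between (zs< (proj₁ (greedyIndices-bound zs zs-distinct g))))) btw))))

      bwd : G m j → Touch O x (a + j) (a + m)
      bwd g with greedyIndices-touch zs zs-distinct g
      ... | inj₁ e = inj₁ (cong (a +_) e)
      ... | inj₂ (i , i<j , gi , vis) = inj₂ (a + i , +-monoʳ-< a i<j , G⇒O i<j gi , empty)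
        where
        In-Q : ∀ {s} → s < n → Between (x (a + j)) (x (a + m)) (x s) → In Q s
        In-Q s<n (inj₁ (h₁ , h₂)) = convex (node-val q∈) s<n
          (≤-trans (leftKey-≤ (inQ j<k)) h₁) (≤-trans h₂ (≤-rightKey (inQ m<k)))
        In-Q s<n (inj₂ (h₁ , h₂)) = convex (node-val q∈) s<n
          (≤-trans (leftKey-≤ (inQ m<k)) h₁) (≤-trans h₂ (≤-rightKey (inQ j<k)))
        empty : ∀ {s u} → O s u → u < a + j → a + i ≤ u → Between (x (a + j)) (x (a + m)) (x s) → s ≡ a + m
        empty {s} {u} o u<t i≤u btw
          with m′ , m′<k , refl ← position (In-Q (proj₁ o) btw)
          with i′ , i′<k , refl ← position {u} (≤-trans (m≤m+n a i) i≤u , ≤-trans (<⇒≤ u<t) (≤end (inQ j<k)))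
          with i′<j ← +-cancelˡ-< a i′ j u<t =
          cong (a +_) (vis (O⇒G m′<k i′<j o) i′<j (+-cancelˡ-≤ a i i′ i≤u) (subst id (z-between m′<k) btw))

  -- Beyond w s says that column s lies on one fixed side of the block w.
  module Near (Beyond : BDT → ℕ → Set) (beyond? : ∀ w s → Dec (Beyond w s))
    (beyond-outside : ∀ {w s} → Beyond w s → ¬ In w s)
    (beyond-⊑ : ∀ {w w′ s} → ValidNode xs w → w ⊑ w′ → Beyond w′ s → Beyond w s)
    (compare : ∀ {w s s′} → Beyond w s → Beyond w s′ → x s ≡ x s′ ⊎ Blocked w s s′ ⊎ Blocked w s′ s)
    where

    InProgress : ℕ → ℕ → BDT → Set
    InProgress t s w = start w < t × t ≤ end w × Beyond w s

    -- `Gr` replaces `Touch` because it is a list membership, decidable as `pick` requires.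
    Extra : ℕ → ℕ → Set
    Extra t s = Gr s t × Any (λ p → Any (InProgress t s) (children p)) (nodes 𝒯)

    extra? : ∀ t s → Dec (Extra t s)
    extra? t s = (x s , t) ∈ₚ? greedyStep xs (out t) t ×-dec
      Any.any? (λ p → Any.any? (λ w → start w <? t ×-dec t ≤? end w ×-dec beyond? w s) (children p)) (nodes 𝒯)

    private
      module _ {t w p} (t<n : t < n) (e : Edge 𝒯 w p) (a<t : start w < t) (t≤e : t ≤ end w) where

        not-blocked : ∀ {s s′} → s < n → s′ < n → Gr s t → Gr s′ t → Beyond w s → Beyond w s′ → ¬ Blocked w s s′
        not-blocked s<n s′<n g g′ by by′ =
          touch-nearest e (<-wellFounded t) a<t t≤e (Gr⇒Touch s<n t<n g) (beyond-outside by)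
            (≰⇒> λ a≤s′ → beyond-outside by′ (a≤s′ , ≤-trans (O-≤ (Gr⇒O s′<n t<n g′)) t≤e))

        unique-beyond : ∀ {s s′} → s < n → s′ < n → Gr s t → Gr s′ t → Beyond w s → Beyond w s′ → s ≡ s′
        unique-beyond s<n s′<n g g′ by by′ with compare by by′
        ... | inj₁ eq = distinct s<n s′<n eq
        ... | inj₂ (inj₁ blk) = contradiction blk (not-blocked s<n s′<n g g′ by by′)
        ... | inj₂ (inj₂ blk) = contradiction blk (not-blocked s′<n s<n g′ g by′ by)

    -- Two blocks in progress are nested, and by `beyond-⊑` both columns are beyond the smaller one,
    -- where neither may block the other. Hence `near` depends on `t` alone, for one point per time
    -- and side and not one per level.
    extra-unique : ∀ {t s s′} → t < n → s < n → s′ < n → Extra t s → Extra t s′ → s ≡ s′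
    extra-unique {t} t<n s<n s′<n (g , anyp) (g′ , anyp′)
      with p , ip , anyw ← find anyp | p′ , ip′ , anyw′ ← find anyp′
      with w , iw , a<t , t≤e , by ← find anyw | w′ , iw′ , a′<t , t≤e′ , by′ ← find anyw′
      with laminar 𝒯 valid (ip , iw) (Edge⇒node 𝒯 (ip′ , iw′)) (<⇒≤ a<t , t≤e) (<⇒≤ a′<t , t≤e′)
    ... | inj₁ w′⊑w = unique-beyond t<n (ip′ , iw′) a′<t t≤e′ s<n s′<n g g′
            (beyond-⊑ (edge-val (ip′ , iw′)) w′⊑w by) by′
    ... | inj₂ p⊑w′ = unique-beyond t<n (ip , iw) a<t t≤e s<n s′<n g g′ by
            (beyond-⊑ (edge-val (ip , iw)) (⊑-trans (child-⊑ (node-val ip) iw) p⊑w′) by′)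

    near : ℕ → ℕ
    near t = pick (extra? t) n

    near-≡ : ∀ {w p s t} → Edge 𝒯 w p → start w < t → t ≤ end w → s < n → t < n → Touch O x t s → Beyond w s → near t ≡ s
    near-≡ {t = t} (ip , iw) a<t t≤e s<n t<n touch by =
      pick-≡ (extra? t) n (λ i<n j<n → extra-unique t<n i<n j<n) s<n
        (Touch⇒Gr s<n t<n touch , lose ip (lose iw (a<t , t≤e , by)))

  private
    leftKey-mono : ∀ {w w′} → ValidNode xs w → w ⊑ w′ → leftKey w′ ≤ leftKey w
    leftKey-mono val sub with l , hl , el ← leftKey-attained val =
      ≤-trans (leftKey-≤ (In-⊑ sub hl)) (≤-reflexive el)

    rightKey-mono : ∀ {w w′} → ValidNode xs w → w ⊑ w′ → rightKey w ≤ rightKey w′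
    rightKey-mono val sub with r , hr , er ← rightKey-attained val =
      ≤-trans (≤-reflexive (sym er)) (≤-rightKey (In-⊑ sub hr))

  private
    compare-left : ∀ {w s s′} → x s < leftKey w → x s′ < leftKey w → x s ≡ x s′ ⊎ Blocked w s s′ ⊎ Blocked w s′ s
    compare-left {s = s} {s′} h h′ with <-cmp (x s) (x s′)
    ... | tri< lt _ _ = inj₂ (inj₁ (inj₁ (lt , h′)))
    ... | tri≈ _ eq _ = inj₁ eq
    ... | tri> _ _ gt = inj₂ (inj₂ (inj₁ (gt , h)))

  module NearLeft = Near (λ w s → x s < leftKey w) (λ w s → x s <? leftKey w)
    (λ lt h → <⇒≱ lt (leftKey-≤ h)) (λ val sub lt → <-≤-trans lt (leftKey-mono val sub)) (λ {w} → compare-left {w})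

  private
    compare-right : ∀ {w s s′} → rightKey w < x s → rightKey w < x s′ → x s ≡ x s′ ⊎ Blocked w s s′ ⊎ Blocked w s′ s
    compare-right {s = s} {s′} h h′ with <-cmp (x s) (x s′)
    ... | tri< lt _ _ = inj₂ (inj₂ (inj₂ (h , lt)))
    ... | tri≈ _ eq _ = inj₁ eq
    ... | tri> _ _ gt = inj₂ (inj₁ (inj₂ (h′ , gt)))

  module NearRight = Near (λ w s → rightKey w < x s) (λ w s → rightKey w <? x s)
    (λ lt h → <⇒≱ lt (≤-rightKey h)) (λ val sub lt → ≤-<-trans (rightKey-mono val sub) lt) (λ {w} → compare-right {w})

  -- Assembly of the cover.

  IsLeafAt : ℕ → BDT → Set
  IsLeafAt s (leaf a b) = a ≤ s × s ≤ b
  IsLeafAt s (node _ _ _) = ⊥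

  isLeafAt? : ∀ s w → Dec (IsLeafAt s w)
  isLeafAt? s (leaf a b) = a ≤? s ×-dec s ≤? b
  isLeafAt? s (node _ _ _) = no id

  LeafEnd : ℕ → ℕ → Set
  LeafEnd s e = Any (λ w → IsLeafAt s w × end w ≡ e) (nodes 𝒯)

  leafEnd? : ∀ s e → Dec (LeafEnd s e)
  leafEnd? s e = Any.any? (λ w → isLeafAt? s w ×-dec end w ≟ e) (nodes 𝒯)

  leafEnd-unique : ∀ {s e e′} → LeafEnd s e → LeafEnd s e′ → e ≡ e′
  leafEnd-unique h h′ with find h | find h′
  ... | leaf _ _ , i , (h₁ , h₂) , refl | leaf _ _ , i′ , (h₁′ , h₂′) , refl =
    ≤-antisym (end-⊑ (leaf-⊑ 𝒯 valid i i′ (h₁ , h₂) (h₁′ , h₂′))) (end-⊑ (leaf-⊑ 𝒯 valid i′ i (h₁′ , h₂′) (h₁ , h₂)))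

  leafEnd : ℕ → ℕ
  leafEnd s = pick (leafEnd? s) n

  leafEnd-≡ : ∀ {a b s} → leaf a b ∈ nodes 𝒯 → In (leaf a b) s → leafEnd s ≡ b
  leafEnd-≡ {a} {b} {s} i (h₁ , h₂) = pick-≡ (leafEnd? s) n (λ _ _ → leafEnd-unique)
    (In⇒<n {leaf a b} (node-val i) (≤-trans h₁ h₂ , ≤-refl)) (lose i ((h₁ , h₂) , refl))

  -- In the first two points the index is a time; in the third it names a column, charged for the
  -- last line of its leaf.
  extras : ℕ → List Point
  extras t = (x (NearLeft.near t) , t) ∷ (x (NearRight.near t) , t) ∷ (x t , leafEnd t) ∷ []

  cover : List Point
  cover = concatMap (nodeCover xs) (nodes 𝒯) ++ concatMap extras (upTo n)

  private
    node-covers : ∀ {v p} → v ∈ nodes 𝒯 → p ∈ nodeCover xs v → p ∈ cover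
    node-covers i j = ∈-++⁺ˡ (∈-concatMap⁺ (nodeCover xs) (lose i j))

    extra-covers : ∀ {t p} → t < n → p ∈ extras t → p ∈ cover
    extra-covers h j = ∈-++⁺ʳ (concatMap (nodeCover xs) (nodes 𝒯)) (∈-concatMap⁺ extras (lose (∈-upTo⁺ h) j))

    covers-leaf : ∀ {a b s t} → leaf a b ∈ nodes 𝒯 → In (leaf a b) s → In (leaf a b) t → O s t → (x s , t) ∈ cover
    covers-leaf {a} {b} {s} {t} q∈ hs ht o with Leaf.leaf-touch q∈ ht o
    ... | inj₁ refl = extra-covers (proj₁ o)
            (there (there (here (cong (x s ,_) (sym (leafEnd-≡ q∈ hs))))))
    ... | inj₂ touch with m , m<k , refl ← Leaf.position q∈ hs | j , j<k , refl ← Leaf.position q∈ ht =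
      node-covers q∈ (∈-map⁺ (λ (m , j) → x (a + m) , a + j)
        (proj₁ (Leaf.agree q∈ (<-wellFounded j) m<k j<k) touch))

    covers-node : ∀ {a b cs m j c d s t} → node a b cs ∈ nodes 𝒯 → At cs m c → At cs j d → m ≢ j →
      In c s → In d t → O s t → (x s , t) ∈ cover
    covers-node {a} {b} {cs} {m} {j} {c} {d} {s} {t} v∈ p q m≢j hs ht o@(s<n , t<n , _) = go (t ≟ b) (O-inv o)
      where
      open Skeleton v∈ hiding (v)
      v = node a b cs
      edge-c = v∈ , At⇒∈ p
      edge-d = v∈ , At⇒∈ q
      d⊑v : d ⊑ v
      d⊑v = child-⊑ (node-val v∈) (At⇒∈ q)
      vs = proj₁ (proj₂ (proj₂ (node-val v∈)))
      con = proj₂ (proj₂ (proj₂ (node-val v∈)))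

      ¬hs : ¬ In d s
      ¬hs h = m≢j (consecutive-At-≡ vs con p q hs h)

      m<j : m < j
      m<j with <-cmp m j
      ... | tri< lt _ _ = lt
      ... | tri≈ _ e _ = contradiction e m≢j
      ... | tri> _ _ gt = contradiction (≤-trans (start≤ hs) (≤-trans (O-≤ o) (≤end ht)))
              (<⇒≱ (consecutive-< cs vs con q p gt))

      border : Border c s
      border = interior edge-c (<-wellFounded t) (<-≤-trans (consecutive-< cs vs con p q m<j) (start≤ ht)) o hs

      atStart : G m j → (x s , start d) ∈ cover
      atStart g = node-covers v∈ (∈-concatMap⁺ (slots xs b cs) (lose g (start∈slots xs p q border)))

      atEnd : ∀ {i e} → G m i → (∀ {y} → y ≡ leftKey c ⊎ y ≡ rightKey c → (y , e) ∈ slots xs b cs (m , i)) →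
        (x s , e) ∈ cover
      atEnd g h = node-covers v∈ (∈-concatMap⁺ (slots xs b cs) (lose g (h border)))

      startTouch⇒G-j : StartTouch c d → G m j
      startTouch⇒G-j = proj₁ (agree (<-wellFounded j) p q m≢j)

      go : Dec (t ≡ b) → Touch O x t s ⊎ Added s t → (x s , t) ∈ cover
      -- Here any ancestor may have added the point, so the diagonal pair pays whether or not the
      -- region is in the skeleton's output.
      go (yes refl) _ = atEnd (touch-greedyIndices zs zs-distinct m<k m<k (inj₁ refl)) (last∈slots xs p)
        where m<k = subst (m <_) (sym (length-map _ cs)) (At-< p)
      go (no t≢b) (inj₁ touch) with m≤n⇒m<n∨m≡n (start≤ ht)
      ... | inj₂ refl = atStart (startTouch⇒G-j (s , hs , touch))
      ... | inj₁ d<t with outside (edge-val edge-d) s<n ¬hs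
      ...   | inj₁ lt = extra-covers t<n (here (cong (λ i → x i , t)
                (sym (NearLeft.near-≡ edge-d d<t (≤end ht) s<n t<n touch lt))))
      ...   | inj₂ gt = extra-covers t<n (there (here (cong (λ i → x i , t)
                (sym (NearRight.near-≡ edge-d d<t (≤end ht) s<n t<n touch gt)))))
      go (no t≢b) (inj₂ add)
        with c∋t ← (≤-trans (Added.start≤u add) (<⇒≤ (Added.u<t add)) , ≤-reflexive (sym (Added.end≡ add)))
        -- Laminarity is applied both ways. The node that caused the addition cannot contain `v`, as
        -- `t` is not `b`; its parent cannot lie in `d`, as column `s` is outside `d`. So it spans
        -- exactly row `d`, and `t` is `end d`.
        with laminar 𝒯 valid edge-d (Edge⇒node 𝒯 (Added.edge add)) ht c∋t
           | laminar 𝒯 valid (Added.edge add) (Edge⇒node 𝒯 edge-d) c∋t ht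
      ... | inj₂ v⊑ | _ = contradiction
              (≤-antisym (≤-trans (≤end ht) (end-⊑ d⊑v)) (≤-trans (end-⊑ v⊑) (≤-reflexive (Added.end≡ add)))) t≢b
      ... | inj₁ _ | inj₂ ⊑d = contradiction (In-⊑ ⊑d
              (In-⊑ (child-⊑ (node-val (proj₁ (Added.edge add))) (Added.ci∈ add)) (Added.inCi add))) ¬hs
      ... | inj₁ ⊑d | inj₁ d⊑ with refl ← ≤-antisym (≤end ht) (≤-trans (end-⊑ d⊑) (≤-reflexive (Added.end≡ add))) =
        atEnd (startTouch⇒G-j (touched-start p q m≢j (≤∧≢⇒< (end-⊑ d⊑v) t≢b) (<-wellFounded (Added.u add)) hs
          (≤-trans (start-⊑ ⊑d) (Added.start≤u add) , <⇒≤ (Added.u<t add)) (Added.older add)))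
          (end∈slots xs p q m≢j)

  covers : ∀ {s t} → In 𝒯 s → In 𝒯 t → O s t → (x s , t) ∈ cover
  covers hs ht o with meet 𝒯 valid hs ht
  ... | inLeaf q∈ hs′ ht′ = covers-leaf q∈ hs′ ht′ o
  ... | atNode v∈ p q m≢j hs′ ht′ = covers-node v∈ p q m≢j hs′ ht′ o

  length-cover : length cover ≡ 4 * sumNonLeaf xs 𝒯 + sumLeaf xs 𝒯 + 3 * n
  length-cover = begin
    length cover
      ≡⟨ length-++ (concatMap (nodeCover xs) (nodes 𝒯)) ⟩
    length (concatMap (nodeCover xs) (nodes 𝒯)) + length (concatMap extras (upTo n))
      ≡⟨ cong₂ _+_ (length-nodeCover xs 𝒯) (length-concatMap extras (λ _ → refl) (upTo n)) ⟩
    4 * sumNonLeaf xs 𝒯 + sumLeaf xs 𝒯 + 3 * length (upTo n)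
      ≡⟨ cong (λ k → 4 * sumNonLeaf xs 𝒯 + sumLeaf xs 𝒯 + 3 * k) (length-upTo n) ⟩
    4 * sumNonLeaf xs 𝒯 + sumLeaf xs 𝒯 + 3 * n ∎
    where open ≡-Reasoning

  unique-out : ∀ t → Unique (out t)
  unique-out zero = []
  unique-out (suc t) = unique-processPairs (stepPairs t 𝒯)
    (unique-insertAll (greedyPoints (out t) (x t) t) (unique-out t))

  rgreedy-bound : (∀ {s} → s < n → In 𝒯 s) →
    RGreedy xs 𝒯 ≤ 4 * sumNonLeaf xs 𝒯 + sumLeaf xs 𝒯 + 3 * n
  rgreedy-bound spans = begin
    RGreedy xs 𝒯                                 ≡⟨ cong length (foldl-upTo (rgreedyStep xs 𝒯) n) ⟩
    length (out n)                               ≤⟨ unique-⊆-length (unique-out n) out⊆cover ⟩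
    length cover                                 ≡⟨ length-cover ⟩
    4 * sumNonLeaf xs 𝒯 + sumLeaf xs 𝒯 + 3 * n   ∎
    where
    open ≤-Reasoning
    out⊆cover : ∀ {p} → p ∈ out n → p ∈ cover
    out⊆cover {y , t} i with t<n ← out-below n i with s , s≤t , refl ← out-keyed n i =
      covers (spans s<n) (spans t<n) (s<n , t<n , i)
      where s<n = ≤-<-trans s≤t t<n

-- Key lists of permutations, and the conclusion.

length-keysOf : ∀ {n} (P : Permutation′ n) → length (keysOf P) ≡ n
length-keysOf {n} P = trans (length-map _ (allFin n)) (length-tabulate id)

lookupD-tabulate : ∀ {A : Set} {n} (f : Fin n → A) (g : A → ℕ) i → lookupD (map g (tabulate f)) (toℕ i) ≡ g (f i)
lookupD-tabulate f g Fin.zero = refl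
lookupD-tabulate f g (Fin.suc i) = lookupD-tabulate (f ∘ Fin.suc) g i

keysOf-distinct : ∀ {n} (P : Permutation′ n) → Distinct (keysOf P)
keysOf-distinct {n} P {s} {t} s<l t<l e = begin
  s                  ≡⟨ toℕ-fromℕ< s<n ⟨
  toℕ (fromℕ< s<n)   ≡⟨ cong toℕ (injective (toℕ-injective (trans (sym (lookup-key s<n)) (trans e (lookup-key t<n))))) ⟩
  toℕ (fromℕ< t<n)   ≡⟨ toℕ-fromℕ< t<n ⟩
  t                  ∎
  where
  open ≡-Reasoning
  s<n = subst (s <_) (length-keysOf P) s<l
  t<n = subst (t <_) (length-keysOf P) t<l
  injective : ∀ {i j} → P ⟨$⟩ʳ i ≡ P ⟨$⟩ʳ j → i ≡ j
  injective {i} {j} e = trans (sym (inverseˡ P)) (trans (cong (P ⟨$⟩ˡ_) e) (inverseˡ P))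
  lookup-key : ∀ {u} (u<n : u < n) → lookupD (keysOf P) u ≡ toℕ (P ⟨$⟩ʳ fromℕ< u<n)
  lookup-key u<n = trans (cong (lookupD (keysOf P)) (sym (toℕ-fromℕ< u<n)))
    (lookupD-tabulate id (λ i → toℕ (P ⟨$⟩ʳ i)) (fromℕ< u<n))

mainTheorem8 : (n : ℕ) (P : Permutation′ n) (𝒯 : BDT) →
    IsBlockDecompositionTree P 𝒯 →
    RGreedy (keysOf P) 𝒯 ≤ 4 * sumNonLeaf (keysOf P) 𝒯 + sumLeaf (keysOf P) 𝒯 + 3 * n
mainTheorem8 n P 𝒯 (start≡0 , 1+end≡n , valid) =
  subst (λ k → RGreedy (keysOf P) 𝒯 ≤ 4 * sumNonLeaf (keysOf P) 𝒯 + sumLeaf (keysOf P) 𝒯 + 3 * k) (length-keysOf P)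
    (Charge.rgreedy-bound (keysOf P) (keysOf-distinct P) 𝒯 valid λ s<l →
      subst (_≤ _) (sym start≡0) z≤n , s≤s⁻¹ (subst (_ <_) (trans (length-keysOf P) (sym 1+end≡n)) s<l))
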